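{- Let $T$ be a tournament and let $H$ be a digraph with $\Delta(G(H))\le 2$. Then the number of copies of $H$ in $T$ equals the number of copies of $H$ in the complement $\overline{T}$ of $T$.
   Context: Digraphs are finite. A tournament is an orientation of a finite complete graph. $\overline{T}$, the complement of $T$, is the tournament obtained from $T$ by reversing all arcs. $G(H)$ is the underlying undirected graph of $H$ and $\Delta$ denotes maximum degree. A copy of $H$ in a tournament is a (not necessarily induced, not necessarily spanning) subdigraph isomorphic to $H$; copies are counted as subdigraphs. -}

module Defs where

open import Data.Fin.Base using (Fin)
open import Data.Fin.Properties using (any?; all?; _≟_)
open import Data.Fin.Subset using (Subset; inside; outside; _∈_)
open import Data.Fin.Subset.Properties using (_∈?_)
open import Data.List.Base as List
  using (List; []; _∷_; allFin; cartesianProductWith; filter; length)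
open import Data.List.Extrema.Nat using (max)
open import Data.Nat.Base using (ℕ; zero; suc)
open import Data.Product.Base using (Σ; ∃; _×_; _,_; proj₁; proj₂)
open import Data.Sum.Base using (_⊎_; [_,_]; swap)
open import Data.Vec.Base as Vec using (Vec; []; _∷_; lookup; tabulate)
open import Data.Vec.Properties using (lookup∘tabulate)
open import Data.Vec.Properties.WithK using ([]=-irrelevant)
open import Function.Base using (flip)
open import Function.Bundles using (_⇔_; mk⇔; _↔_; mk↔ₛ′; Inverse; Equivalence)
open import Level using (0ℓ)
open import Relation.Binary.Core using (Rel)
open import Relation.Binary.Definitions
  using (Decidable; Irreflexive; Symmetric; Trichotomous; Tri; tri<; tri≈; tri>)
open import Relation.Binary.PropositionalEquality
  using (_≡_; refl; sym; trans; cong; subst; subst₂)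
open import Relation.Nullary using (Dec; yes; no)
open import Relation.Nullary.Decidable using (map′; _×-dec_; _⊎-dec_; _→-dec_)
import Relation.Unary as Unary

private
  variable
    k n : ℕ
    V W A : Set

-- Loopless, without parallel arcs; a pair of opposite arcs is allowed.
record Digraph (V : Set) : Set₁ where
  field
    Arc    : Rel V 0ℓ
    arc?   : Decidable Arc
    irrefl : Irreflexive _≡_ Arc

-- Trichotomy: for distinct u and v exactly one of the arcs u → v, v → u is
-- present.
record Tournament (n : ℕ) : Set₁ where
  field
    digraph      : Digraph (Fin n)
    trichotomous : Trichotomous _≡_ (Digraph.Arc digraph)

complement : Tournament n → Tournament n
complement T = record
  { digraph = record
    { Arc    = flip Arc
    ; arc?   = flip arc?
    ; irrefl = λ u≡v → irrefl (sym u≡v)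
    }
  ; trichotomous = λ u v → reverse (trichotomous u v)
  }
  where
  open Tournament T
  open Digraph digraph
  reverse : ∀ {P Q R : Set} → Tri P Q R → Tri R Q P
  reverse (tri< p ¬q ¬r) = tri> ¬r ¬q p
  reverse (tri≈ ¬p q ¬r) = tri≈ ¬r q ¬p
  reverse (tri> ¬p ¬q r) = tri< r ¬q ¬p

record Graph (V : Set) : Set₁ where
  field
    Adj       : Rel V 0ℓ
    adj?      : Decidable Adj
    symmetric : Symmetric Adj
    irrefl    : Irreflexive _≡_ Adj

underlying : Digraph V → Graph V
underlying D = record
  { Adj       = λ u v → Arc u v ⊎ Arc v u
  ; adj?      = λ u v → arc? u v ⊎-dec arc? v u
  ; symmetric = swap
  ; irrefl    = λ u≡v → [ irrefl u≡v , irrefl (sym u≡v) ]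
  }
  where open Digraph D

degree : Graph (Fin k) → Fin k → ℕ
degree {k} G v = length (filter (Graph.adj? G v) (allFin k))

Δ : Graph (Fin k) → ℕ
Δ {k} G = max 0 (List.map (degree G) (allFin k))

_≅_ : Digraph V → Digraph W → Set
_≅_ {V} {W} G H =
  Σ (V ↔ W) λ φ → ∀ u v →
    Digraph.Arc G u v ⇔ Digraph.Arc H (Inverse.to φ u) (Inverse.to φ v)

-- A set of vertices together with a set of ordered pairs; the pairs are
-- stored by first component, as out-neighbourhoods.  Using vectors makes
-- _≡_ on this type coincide with equality of the two sets.
record VertexArcSets (n : ℕ) : Set where
  constructor mkSets
  field
    vertices : Subset n
    out      : Vec (Subset n) n

  HasArc : Rel (Fin n) 0ℓ
  HasArc u v = v ∈ lookup out u

  hasArc? : Decidable HasArc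
  hasArc? u v = v ∈? lookup out u

  Vertex : Set
  Vertex = ∃ λ v → v ∈ vertices

open VertexArcSets public

IsSubdigraphOf : VertexArcSets n → Digraph (Fin n) → Set
IsSubdigraphOf S D = ∀ u v → HasArc S u v →
  u ∈ vertices S × v ∈ vertices S × Digraph.Arc D u v

isSubdigraphOf? : (S : VertexArcSets n) (D : Digraph (Fin n)) → Dec (IsSubdigraphOf S D)
isSubdigraphOf? S D = all? λ u → all? λ v → hasArc? S u v →-dec
  (u ∈? vertices S ×-dec v ∈? vertices S ×-dec Digraph.arc? D u v)

subdigraph : (D : Digraph (Fin n)) (S : VertexArcSets n) → IsSubdigraphOf S D →
             Digraph (Vertex S)
subdigraph D S S⊆D = record
  { Arc    = λ u v → HasArc S (proj₁ u) (proj₁ v)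
  ; arc?   = λ u v → hasArc? S (proj₁ u) (proj₁ v)
  ; irrefl = λ u≡v uv → Digraph.irrefl D (cong proj₁ u≡v) (proj₂ (proj₂ (S⊆D _ _ uv)))
  }

IsCopy : Digraph (Fin k) → (D : Digraph (Fin n)) → VertexArcSets n → Set
IsCopy H D S = Σ (IsSubdigraphOf S D) λ S⊆D → H ≅ subdigraph D S S⊆D

-- Isomorphism is decided by searching through all vertex maps Fin k → Fin n,
-- represented as vectors.
anyVec? : ∀ {P : Vec (Fin n) k → Set} → Unary.Decidable P → Dec (∃ P)
anyVec? {k = zero}  P? = map′ ([] ,_) (λ { ([] , p) → p }) (P? [])
anyVec? {k = suc k} P? =
  map′ (λ { (x , xs , p) → x ∷ xs , p }) (λ { (x ∷ xs , p) → x , xs , p })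
       (any? λ x → anyVec? λ xs → P? (x ∷ xs))

_⇔-dec_ : ∀ {P Q : Set} → Dec P → Dec Q → Dec (P ⇔ Q)
p? ⇔-dec q? =
  map′ (λ { (f , g) → mk⇔ f g }) (λ e → Equivalence.to e , Equivalence.from e)
       ((p? →-dec q?) ×-dec (q? →-dec p?))

module _ (H : Digraph (Fin k)) (S : VertexArcSets n) where
  open Digraph H using (Arc; arc?)

  IsIso : (Fin k → Fin n) → Set
  IsIso f = (∀ i → f i ∈ vertices S)
          × (∀ v → v ∈ vertices S → ∃ λ i → f i ≡ v)
          × (∀ i j → f i ≡ f j → i ≡ j)
          × (∀ i j → Arc i j ⇔ HasArc S (f i) (f j))

  isIso? : Unary.Decidable IsIso
  isIso? f = (all? λ i → f i ∈? vertices S)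
       ×-dec (all? λ v → v ∈? vertices S →-dec any? λ i → f i ≟ v)
       ×-dec (all? λ i → all? λ j → f i ≟ f j →-dec i ≟ j)
       ×-dec (all? λ i → all? λ j → arc? i j ⇔-dec hasArc? S (f i) (f j))

  IsIso-resp : ∀ {f g} → (∀ i → f i ≡ g i) → IsIso f → IsIso g
  IsIso-resp f≗g (into , onto , inj , arcs) =
      (λ i → subst (_∈ vertices S) (f≗g i) (into i))
    , (λ v v∈S → let (i , fi≡v) = onto v v∈S in i , trans (sym (f≗g i)) fi≡v)
    , (λ i j gi≡gj → inj i j (trans (f≗g i) (trans gi≡gj (sym (f≗g j)))))
    , (λ i j → subst₂ (λ x y → Arc i j ⇔ HasArc S x y) (f≗g i) (f≗g j) (arcs i j))

  Vertex-≡ : {u v : Vertex S} → proj₁ u ≡ proj₁ v → u ≡ v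
  Vertex-≡ {u , p} {.u , q} refl = cong (u ,_) ([]=-irrelevant p q)

  module _ (D : Digraph (Fin n)) (S⊆D : IsSubdigraphOf S D) where

    toIso : ∀ {f} → IsIso f → H ≅ subdigraph D S S⊆D
    toIso {f} (into , onto , inj , arcs) =
        mk↔ₛ′ (λ i → f i , into i)
              (λ { (v , v∈S) → proj₁ (onto v v∈S) })
              (λ { (v , v∈S) → Vertex-≡ (proj₂ (onto v v∈S)) })
              (λ i → inj _ _ (proj₂ (onto (f i) (into i))))
      , arcs

    fromIso : (φ : H ≅ subdigraph D S S⊆D) →
              IsIso (λ i → proj₁ (Inverse.to (proj₁ φ) i))
    fromIso (φ , arcs) =
        (λ i → proj₂ (to i))
      , (λ v v∈S → from (v , v∈S) , cong proj₁ (strictlyInverseˡ (v , v∈S)))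
      , (λ i j eq → trans (sym (strictlyInverseʳ i))
                      (trans (cong from (Vertex-≡ eq)) (strictlyInverseʳ j)))
      , arcs
      where open Inverse φ

    iso? : Dec (H ≅ subdigraph D S S⊆D)
    iso? = map′
      (λ { (_ , iso) → toIso iso })
      (λ φ → let f = λ i → proj₁ (Inverse.to (proj₁ φ) i) in
             tabulate f , IsIso-resp (λ i → sym (lookup∘tabulate f i)) (fromIso φ))
      (anyVec? λ xs → isIso? (lookup xs))

isCopy? : (H : Digraph (Fin k)) (D : Digraph (Fin n)) → Unary.Decidable (IsCopy H D)
isCopy? H D S with isSubdigraphOf? S D
... | no  S⊈D = no λ (S⊆D , _) → S⊈D S⊆D
... | yes S⊆D = map′ (S⊆D ,_) proj₂ (iso? H S D S⊆D)

allVecs : List A → ∀ n → List (Vec A n)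
allVecs xs zero    = [] ∷ []
allVecs xs (suc n) = cartesianProductWith _∷_ xs (allVecs xs n)

allSubsets : ∀ n → List (Subset n)
allSubsets n = allVecs (outside ∷ inside ∷ []) n

-- Every element of VertexArcSets n, exactly once.
allVertexArcSets : ∀ n → List (VertexArcSets n)
allVertexArcSets n =
  cartesianProductWith mkSets (allSubsets n) (allVecs (allSubsets n) n)

#copies : Digraph (Fin k) → Digraph (Fin n) → ℕ
#copies {n = n} H D = length (filter (isCopy? H D) (allVertexArcSets n))

{-# OPTIONS --safe #-}

-- Each copy of H in T is the image of |Aut H| embeddings, so it is enough to
-- count embeddings.  Put s(u,v) = 1 if u → v, −1 if v → u, and 0 if u = v.  For
-- u ≠ v the indicator of u → v is (1 + s(u,v))/2, so if H has m arcs, the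
-- number of embeddings is 2⁻ᵐ times the sum over all injective f of the product
-- of 1 + s(f i, f j) over the arcs (i,j).  Expanding the product gives the sums
-- W(L) of Π_{(i,j) ∈ L} s(f i, f j) for sets L of arcs.  Passing to the
-- complement replaces s by −s and W(L) by (−1)^|L| W(L), so W must vanish on all
-- L of odd size.  Such an L has a component with an odd number of edges.  The
-- component is a path or a cycle, and relabelling the vertices by its reflection
-- turns round each of its edges and nothing else, whence W(L) = −W(L).
-- If H has a pair of opposite arcs, neither tournament contains a copy.
module Submission where

import Data.Bool.Properties as Bool
open import Data.Fin.Base using (Fin; zero; suc)
open import Data.Fin.Permutation as Perm
  using (Permutation′; _⟨$⟩ʳ_; _⟨$⟩ˡ_; _∘ₚ_; transpose)
open import Data.Fin.Properties using (_≟_; suc-injective; all?; any?)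
open import Data.Fin.Subset using (Subset; inside; outside)
import Data.Fin.Subset as Subset
open import Data.Fin.Subset.Properties using (⊆-antisym)
open import Data.Integer.Base as ℤ using (ℤ; 0ℤ; 1ℤ; -1ℤ; +≤+)
import Data.Integer.Properties as ℤ
open import Data.List.Base as List
  using (List; []; _∷_; _++_; _∷ʳ_; map; filter; length; reverse; allFin; cartesianProductWith)
open import Data.List.Extrema.Nat using (xs≤max)
import Data.List.Properties as List
open import Data.List.Membership.Propositional using (_∈_; _∉_)
open import Data.List.Membership.Propositional.Properties
  using (∈-map⁺; ∈-allFin; ∈-filter⁺; ∈-filter⁻; ∈-cartesianProduct⁺)
open import Data.List.Relation.Binary.Permutation.Propositional as ↭
  using (_↭_; ↭-sym; ↭-trans; ↭-refl; ↭-reflexive; ↭⇒↭ₛ)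
import Data.List.Relation.Binary.Permutation.Propositional.Properties as ↭ₚ
import Data.List.Relation.Binary.Permutation.Setoid.Properties as ↭ₛ
open import Data.List.Relation.Unary.All as All using (All; []; _∷_)
import Data.List.Relation.Unary.All.Properties as All
open import Data.List.Relation.Unary.AllPairs using ([]; _∷_)
open import Data.List.Relation.Unary.Any using (here; there)
open import Data.List.Relation.Unary.Unique.Propositional using (Unique)
open import Data.Nat.Base as ℕ using (ℕ; zero; suc; z≤n; s≤s; _≤_)
import Data.Nat.Properties as ℕ
open import Data.Product.Base using (∃; _×_; _,_; proj₁; proj₂)
open import Data.Sum.Base using (_⊎_; inj₁; inj₂)
open import Data.Vec.Base as Vec using (Vec; []; _∷_; lookup; tabulate)
import Data.Vec.Properties as Vec
open import Function.Base using (_∘_; id; flip)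
open import Function.Bundles using (_⇔_; mk⇔; Equivalence)
open import Relation.Binary.Definitions using (DecidableEquality; tri<; tri≈; tri>)
open import Relation.Binary.PropositionalEquality
  using (_≡_; _≢_; _≗_; refl; sym; trans; cong; cong₂; subst; subst₂; setoid; module ≡-Reasoning)
open import Relation.Nullary using (Dec; yes; no; does; ¬_; contradiction)
open import Relation.Nullary.Decidable using (_×-dec_; _⊎-dec_; _→-dec_; dec-true)
open import Relation.Unary using (Decidable)
open import Defs

private
  variable
    A B C P Q : Set
    k n : ℕ

-- Multigraphs of maximum degree two

module Trails where
  open import Data.Nat.Base using (_+_; _*_)
  open import Data.Nat.Tactic.RingSolver using (solve-∀)

  Edge : ℕ → Set
  Edge k = Fin k × Fin k

  opposite : Edge k → Edge k
  opposite (i , j) = j , i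

  relabel : Permutation′ k → Edge k → Edge k
  relabel π (i , j) = π ⟨$⟩ʳ i , π ⟨$⟩ʳ j

  -- All that the combinatorial argument uses of the signed sums over injective maps. Edges carry an
  -- orientation because turning one round costs a sign.
  record Alternating (W : List (Edge k) → ℤ) : Set where
    field
      W-↭       : ∀ {L L′} → L ↭ L′ → W L ≡ W L′
      W-flip    : ∀ i j L → W ((i , j) ∷ L) ≡ ℤ.- W ((j , i) ∷ L)
      W-relabel : ∀ π L → W (map (relabel π) L) ≡ W L

  -- Edge lists up to order and orientation

  infix 4 _~_

  -- Related lists describe the same undirected multigraph. The sign incurred is not recorded: the
  -- relation transports lengths, degrees and the vanishing of `W`, none of which depend on it.
  data _~_ {k} : List (Edge k) → List (Edge k) → Set where
    reorient    : ∀ i j L → (i , j) ∷ L ~ (j , i) ∷ L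
    permute : ∀ {L L′} → L ↭ L′ → L ~ L′
    ~-trans : ∀ {L L′ L″} → L ~ L′ → L′ ~ L″ → L ~ L″

  ~-++ʳ : ∀ {L L′ : List (Edge k)} M → L ~ L′ → L ++ M ~ L′ ++ M
  ~-++ʳ M (reorient i j L)  = reorient i j (L ++ M)
  ~-++ʳ M (permute p)   = permute (↭ₚ.++⁺ʳ M p)
  ~-++ʳ M (~-trans p q) = ~-trans (~-++ʳ M p) (~-++ʳ M q)

  ~-++ˡ : ∀ {L L′ : List (Edge k)} M → L ~ L′ → M ++ L ~ M ++ L′
  ~-++ˡ {L = L} {L′} M p =
    ~-trans (permute (↭ₚ.++-comm M L)) (~-trans (~-++ʳ M p) (permute (↭ₚ.++-comm L′ M)))

  ~-opposite : ∀ (L : List (Edge k)) → L ~ map opposite L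
  ~-opposite []            = permute ↭-refl
  ~-opposite ((i , j) ∷ L) = ~-trans (reorient i j L) (~-++ˡ ((j , i) ∷ []) (~-opposite L))

  ~-length : ∀ {L L′ : List (Edge k)} → L ~ L′ → length L ≡ length L′
  ~-length (reorient i j L)  = refl
  ~-length (permute p)   = ↭ₚ.↭-length p
  ~-length (~-trans p q) = trans (~-length p) (~-length q)

  δ : Fin k → Fin k → ℕ
  δ v i with v ≟ i
  ... | yes _ = 1
  ... | no  _ = 0

  δ-refl : ∀ (v : Fin k) → δ v v ≡ 1
  δ-refl v with v ≟ v
  ... | yes _  = refl
  ... | no v≢v = contradiction refl v≢v

  δ-≢ : ∀ {v i : Fin k} → v ≢ i → δ v i ≡ 0
  δ-≢ {v = v} {i} v≢i with v ≟ i
  ... | yes v≡i = contradiction v≡i v≢i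
  ... | no _    = refl

  -- A loop counts twice, which lets it be treated as a closed trail with one vertex.
  deg : Fin k → List (Edge k) → ℕ
  deg v []            = 0
  deg v ((i , j) ∷ L) = δ v i + δ v j + deg v L

  deg-++ : ∀ (v : Fin k) L M → deg v (L ++ M) ≡ deg v L + deg v M
  deg-++ v []            M = refl
  deg-++ v ((i , j) ∷ L) M = trans (cong (δ v i + δ v j +_) (deg-++ v L M))
                                     (sym (ℕ.+-assoc (δ v i + δ v j) _ _))

  deg-↭ : ∀ (v : Fin k) {L M} → L ↭ M → deg v L ≡ deg v M
  deg-↭ v ↭.refl                    = refl
  deg-↭ v (↭.prep (i , j) p)        = cong (δ v i + δ v j +_) (deg-↭ v p)
  deg-↭ v (↭.swap (i , j) (i′ , j′) p) =
    trans (cong (λ d → δ v i + δ v j + (δ v i′ + δ v j′ + d)) (deg-↭ v p))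
            (exchange (δ v i + δ v j) (δ v i′ + δ v j′) _)
    where
    exchange : ∀ a b c → a + (b + c) ≡ b + (a + c)
    exchange = solve-∀
  deg-↭ v (↭.trans p q)             = trans (deg-↭ v p) (deg-↭ v q)

  deg-~ : ∀ (v : Fin k) {L M} → L ~ M → deg v L ≡ deg v M
  deg-~ v (reorient i j L)  = cong (_+ deg v L) (ℕ.+-comm (δ v i) (δ v j))
  deg-~ v (permute p)   = deg-↭ v p
  deg-~ v (~-trans p q) = trans (deg-~ v p) (deg-~ v q)

  -- Vertices of degree zero are not ends of any edge of `L`, so `π` may move them freely.
  relabel-fixes : ∀ (π : Permutation′ k) L → (∀ v → π ⟨$⟩ʳ v ≡ v ⊎ deg v L ≡ 0) →
                  map (relabel π) L ≡ L
  relabel-fixes π []            fixes = refl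
  relabel-fixes π ((i , j) ∷ L) fixes = cong₂ _∷_ (cong₂ _,_ fix-i fix-j) (relabel-fixes π L rest)
    where
    fix-i : π ⟨$⟩ʳ i ≡ i
    fix-i with fixes i
    ... | inj₁ eq  = eq
    ... | inj₂ d≡0 with () ← trans (sym (δ-refl i)) (ℕ.m+n≡0⇒m≡0 _ (ℕ.m+n≡0⇒m≡0 (δ i i + δ i j) d≡0))

    fix-j : π ⟨$⟩ʳ j ≡ j
    fix-j with fixes j
    ... | inj₁ eq  = eq
    ... | inj₂ d≡0 with () ← trans (sym (δ-refl j)) (ℕ.m+n≡0⇒n≡0 (δ j i) (ℕ.m+n≡0⇒m≡0 (δ j i + δ j j) d≡0))

    rest : ∀ v → π ⟨$⟩ʳ v ≡ v ⊎ deg v L ≡ 0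
    rest v with fixes v
    ... | inj₁ eq  = inj₁ eq
    ... | inj₂ d≡0 = inj₂ (ℕ.m+n≡0⇒n≡0 (δ v i + δ v j) d≡0)

  transpose-left : ∀ (i j : Fin k) → transpose i j ⟨$⟩ʳ i ≡ j
  transpose-left i j with i ≟ i
  ... | yes _  = refl
  ... | no i≢i = contradiction refl i≢i

  transpose-right : ∀ (i j : Fin k) → transpose i j ⟨$⟩ʳ j ≡ i
  transpose-right i j with j ≟ i
  ... | yes j≡i = j≡i
  ... | no _ with j ≟ j
  ...   | yes _  = refl
  ...   | no j≢j = contradiction refl j≢j

  transpose-other : ∀ {i j v : Fin k} → v ≢ i → v ≢ j → transpose i j ⟨$⟩ʳ v ≡ v
  transpose-other {i = i} {j} {v} v≢i v≢j with v ≟ i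
  ... | yes v≡i = contradiction v≡i v≢i
  ... | no _ with v ≟ j
  ...   | yes v≡j = contradiction v≡j v≢j
  ...   | no _    = refl

  -- Vertex permutations from rearrangements of lists

  Unique-↭ : ∀ {xs ys : List (Fin k)} → xs ↭ ys → Unique xs → Unique ys
  Unique-↭ p = ↭ₛ.Unique-resp-↭ (setoid _) (↭⇒↭ₛ p)

  ∉-tail : ∀ {x : Fin k} {xs} → All (x ≢_) xs → x ∉ xs
  ∉-tail = All.All¬⇒¬Any

  -- The derivation of `xs ↭ ys` becomes a product of transpositions, one for each `swap`. Fixing
  -- all vertices outside the list is part of the induction: it keeps the permutation found for a
  -- tail from disturbing the entries in front.
  rearrangement : ∀ {xs ys : List (Fin k)} → Unique xs → xs ↭ ys →
                  ∃ λ π → map (π ⟨$⟩ʳ_) xs ≡ ys × (∀ v → v ∉ xs → π ⟨$⟩ʳ v ≡ v)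
  rearrangement unq ↭.refl = Perm.id , List.map-id _ , λ _ _ → refl
  rearrangement (x≢ ∷ unq) (↭.prep x p) with π , eq , fix ← rearrangement unq p =
    π , cong₂ _∷_ (fix x (∉-tail x≢)) eq , λ v v∉ → fix v (v∉ ∘ there)
  rearrangement ((x≢y ∷ x≢) ∷ y≢ ∷ unq) (↭.swap {xs = xs} x y p) with π , eq , fix ← rearrangement unq p =
    -- The transposition acts first. It fixes the entries of `xs`, and `π` fixes `x` and `y`; both
    -- facts rest on distinctness.
    transpose x y ∘ₚ π ,
    cong₂ _∷_ (trans (cong (π ⟨$⟩ʳ_) (transpose-left x y)) (fix y (∉-tail y≢)))
      (cong₂ _∷_ (trans (cong (π ⟨$⟩ʳ_) (transpose-right x y)) (fix x (∉-tail x≢)))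
        (trans (List.map-cong-local
                   (All.zipWith (λ (x≢v , y≢v) → cong (π ⟨$⟩ʳ_) (transpose-other (x≢v ∘ sym) (y≢v ∘ sym))) (x≢ , y≢)))
                 eq)) ,
    λ v v∉ → trans (cong (π ⟨$⟩ʳ_) (transpose-other (v∉ ∘ here) (v∉ ∘ there ∘ here))) (fix v (v∉ ∘ there ∘ there))
  rearrangement {xs = xs} unq (↭.trans p q)
    with π , eq , fix ← rearrangement unq p
    with ρ , eq′ , fix′ ← rearrangement (Unique-↭ p unq) q =
    π ∘ₚ ρ ,
    trans (List.map-∘ xs) (trans (cong (map (ρ ⟨$⟩ʳ_)) eq) eq′) ,
    λ v v∉ → trans (cong (ρ ⟨$⟩ʳ_) (fix v v∉)) (fix′ v (v∉ ∘ ↭ₚ.∈-resp-↭ (↭-sym p)))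

  -- Trails and their reflections

  trail : Fin k → List (Fin k) → List (Edge k)
  trail x []       = []
  trail x (y ∷ ys) = (x , y) ∷ trail y ys

  last : Fin k → List (Fin k) → Fin k
  last x []       = x
  last x (y ∷ ys) = last y ys

  count : Fin k → List (Fin k) → ℕ
  count v []       = 0
  count v (x ∷ xs) = δ v x + count v xs

  ∈⇒count : ∀ {v : Fin k} {xs} → v ∈ xs → 1 ≤ count v xs
  ∈⇒count {v = v} (here refl) = ℕ.≤-trans (ℕ.≤-reflexive (sym (δ-refl v))) (ℕ.m≤m+n _ _)
  ∈⇒count (there v∈)   = ℕ.≤-trans (∈⇒count v∈) (ℕ.m≤n+m _ _)

  ∉⇒count : ∀ {v : Fin k} xs → v ∉ xs → count v xs ≡ 0
  ∉⇒count []       v∉ = refl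
  ∉⇒count (x ∷ xs) v∉ = cong₂ _+_ (δ-≢ (v∉ ∘ here)) (∉⇒count xs (v∉ ∘ there))

  -- Closing the trail up by an edge between its ends makes every visit count two.
  deg-trail : ∀ (v x : Fin k) xs →
              deg v (trail x xs) + δ v x + δ v (last x xs) ≡ 2 * count v (x ∷ xs)
  deg-trail v x []       = double (δ v x)
    where
    double : ∀ a → a + a ≡ 2 * (a + 0)
    double = solve-∀
  deg-trail v x (y ∷ ys) = begin
    δ v x + δ v y + deg v (trail y ys) + δ v x + δ v l    ≡⟨ regroup (δ v x) (δ v y) _ _ ⟩
    2 * δ v x + (deg v (trail y ys) + δ v y + δ v l)      ≡⟨ cong (2 * δ v x +_) (deg-trail v y ys) ⟩
    2 * δ v x + 2 * count v (y ∷ ys)                      ≡⟨ ℕ.*-distribˡ-+ 2 (δ v x) _ ⟨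
    2 * count v (x ∷ y ∷ ys)                              ∎
    where
    open ≡-Reasoning
    l = last y ys
    regroup : ∀ a b c d → a + b + c + a + d ≡ 2 * a + (c + b + d)
    regroup = solve-∀

  deg-trail-∈ : ∀ {v x : Fin k} {xs} → v ∈ x ∷ xs →
                2 ≤ deg v (trail x xs) + δ v x + δ v (last x xs)
  deg-trail-∈ {v = v} {x} {xs} v∈ =
    subst (2 ≤_) (sym (deg-trail v x xs)) (ℕ.*-monoʳ-≤ 2 (∈⇒count v∈))

  deg-trail-∉ : ∀ {v x : Fin k} {xs} → v ∉ x ∷ xs → deg v (trail x xs) ≡ 0
  deg-trail-∉ {v = v} {x} {xs} v∉ = ℕ.m+n≡0⇒m≡0 _ (ℕ.m+n≡0⇒m≡0 (deg v (trail x xs) + δ v x)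
    (trans (deg-trail v x xs) (cong (2 *_) (∉⇒count (x ∷ xs) v∉))))

  trail-∷ʳ : ∀ (x : Fin k) xs y → trail x (xs ∷ʳ y) ≡ trail x xs ∷ʳ (last x xs , y)
  trail-∷ʳ x []       y = refl
  trail-∷ʳ x (z ∷ zs) y = cong ((x , z) ∷_) (trail-∷ʳ z zs y)

  last-∷ʳ : ∀ (x : Fin k) xs y → last x (xs ∷ʳ y) ≡ y
  last-∷ʳ x []       y = refl
  last-∷ʳ x (z ∷ zs) y = last-∷ʳ z zs y

  -- The reversed vertex list is given with its head split off, so that `trail` and `last` apply to
  -- it again. Each step of the induction appends the old first vertex at the far end, which adds
  -- the old first edge turned round.
  reverse-trail : ∀ (x : Fin k) xs → ∃ λ ys → reverse (x ∷ xs) ≡ last x xs ∷ ys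
    × last (last x xs) ys ≡ x × trail (last x xs) ys ↭ map opposite (trail x xs)
  reverse-trail x []       = [] , refl , refl , ↭-refl
  reverse-trail x (y ∷ zs) with ys , rev , end , perm ← reverse-trail y zs =
    ys ∷ʳ x ,
    trans (List.unfold-reverse x (y ∷ zs)) (cong (_∷ʳ x) rev) ,
    last-∷ʳ l ys x ,
    ↭-trans (↭-reflexive (trans (trail-∷ʳ l ys x) (cong (λ z → trail l ys ∷ʳ (z , x)) end)))
      (↭-trans (↭-sym (↭ₚ.∷↭∷ʳ _ _)) (↭.prep (y , x) perm))
    where l = last y zs

  relabel-trail : ∀ (π : Permutation′ k) x xs →
                  map (relabel π) (trail x xs) ≡ trail (π ⟨$⟩ʳ x) (map (π ⟨$⟩ʳ_) xs)
  relabel-trail π x []       = refl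
  relabel-trail π x (y ∷ ys) = cong (_ ∷_) (relabel-trail π y ys)

  relabel-last : ∀ (π : Permutation′ k) x xs →
                 π ⟨$⟩ʳ last x xs ≡ last (π ⟨$⟩ʳ x) (map (π ⟨$⟩ʳ_) xs)
  relabel-last π x []       = refl
  relabel-last π x (y ∷ ys) = relabel-last π y ys

  -- As the vertices are distinct, passing from their list to its reverse extends to a permutation.
  -- The exchange of the two ends is recorded for the sake of an edge joining them.
  reflection : ∀ (x : Fin k) xs → Unique (x ∷ xs) → ∃ λ π →
    map (relabel π) (trail x xs) ↭ map opposite (trail x xs)
    × π ⟨$⟩ʳ x ≡ last x xs × π ⟨$⟩ʳ last x xs ≡ x × (∀ v → v ∉ x ∷ xs → π ⟨$⟩ʳ v ≡ v)
  reflection x xs unq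
    with ys , rev , end , perm ← reverse-trail x xs
    with π , eq , fix ← rearrangement unq (↭-trans (↭-sym (↭ₚ.↭-reverse (x ∷ xs))) (↭-reflexive rev))
    = π ,
      ↭-trans (↭-reflexive (trans (relabel-trail π x xs) (cong₂ trail eqˣ eqˢ))) perm ,
      eqˣ ,
      trans (relabel-last π x xs) (trans (cong₂ last eqˣ eqˢ) end) ,
      fix
    where
    eqˣ = List.∷-injectiveˡ eq
    eqˢ = List.∷-injectiveʳ eq

  -- Splitting off a component

  module _ {k : ℕ} where
    open import Data.List.Membership.DecPropositional (_≟_ {k}) public using (_∈?_)

  -- The last field keeps the reflection away from the remaining edges, and from
  -- any edges beside L.
  record Component (b : ℕ) (L : List (Edge k)) : Set where
    field
      part rest  : List (Edge k)
      decomposes : L ~ part ++ rest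
      bounded    : length rest ≤ b
      reflect    : Permutation′ k
      reverses   : map (relabel reflect) part ↭ map opposite part
      separates  : ∀ v → (reflect ⟨$⟩ʳ v ≡ v × deg v part ≡ 0) ⊎ (1 ≤ deg v L × deg v rest ≡ 0)

  Component-~ : ∀ {b b′} {L L′ : List (Edge k)} → b ≤ b′ → L′ ~ L → Component b L → Component b′ L′
  Component-~ {L = L} {L′} b≤b′ L′~L c = record
    { part       = part
    ; rest       = rest
    ; decomposes = ~-trans L′~L decomposes
    ; bounded    = ℕ.≤-trans bounded b≤b′
    ; reflect    = reflect
    ; reverses   = reverses
    ; separates  = λ v → subst (λ d → (reflect ⟨$⟩ʳ v ≡ v × deg v part ≡ 0) ⊎ (1 ≤ d × deg v rest ≡ 0))
                     (sym (deg-~ v L′~L)) (separates v)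
    }
    where open Component c

  MaxDegree≤2 : List (Edge k) → Set
  MaxDegree≤2 L = ∀ v → deg v L ≤ 2

  -- The second alternative of `separates` asks for an incident edge at each vertex of the trail.
  -- This is carried along because a trail of one vertex has no edge to supply it.
  Touched : List (Fin k) → List (Edge k) → Set
  Touched xs L = ∀ {v} → v ∈ xs → 1 ≤ deg v L

  -- Decides whether the trail is already a whole component. In the second case the edge is turned
  -- so that its first end lies on the trail; the other end is unrestricted and may lie there too.
  incident-edge : ∀ (xs : List (Fin k)) R → (∀ {v} → v ∈ xs → deg v R ≡ 0) ⊎
    ∃ λ z → ∃ λ y → ∃ λ R′ → z ∈ xs × R ~ (z , y) ∷ R′
  incident-edge xs []            = inj₁ λ _ → refl
  incident-edge xs ((i , j) ∷ R) with i ∈? xs | j ∈? xs | incident-edge xs R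
  ... | yes i∈ | _      | _         = inj₂ (i , j , R , i∈ , permute ↭-refl)
  ... | no _   | yes j∈ | _         = inj₂ (j , i , R , j∈ , reorient i j R)
  ... | no _   | no _   | inj₂ (z , y , R′ , z∈ , R~) =
    inj₂ (z , y , (i , j) ∷ R′ , z∈ , ~-trans (~-++ˡ ((i , j) ∷ []) R~) (permute (↭.swap _ _ ↭-refl)))
  ... | no i∉  | no j∉  | inj₁ free = inj₁ λ v∈ →
    cong₂ _+_ (cong₂ _+_ (δ-≢ (λ v≡i → i∉ (subst (_∈ xs) v≡i v∈))) (δ-≢ (λ v≡j → j∉ (subst (_∈ xs) v≡j v∈)))) (free v∈)

  -- Here `t` is the degree of a vertex in a trail, `a` and `b` are the contributions of the edge
  -- joining its ends, and `r` is the degree in the remaining edges. The closed trail uses up the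
  -- permitted degree.
  saturated : ∀ {t a b r} → 2 ≤ t + a + b → a + b + (t + r) ≤ 2 → r ≡ 0
  saturated {t} {a} {b} {r} lower upper = ℕ.n≤0⇒n≡0 (ℕ.+-cancelˡ-≤ (t + a + b) r 0 (begin
    t + a + b + r    ≡⟨ regroup t a b r ⟩
    a + b + (t + r)  ≤⟨ upper ⟩
    2                ≤⟨ lower ⟩
    t + a + b        ≡⟨ ℕ.+-identityʳ _ ⟨
    t + a + b + 0    ∎))
    where
    open ℕ.≤-Reasoning
    regroup : ∀ t a b r → t + a + b + r ≡ a + b + (t + r)
    regroup = solve-∀

  -- Every vertex of the closed trail already has degree two, so the remaining edges avoid it. The
  -- reflection exchanges the ends and so turns the closing edge round too. Loops and double edges
  -- are the cases of one and two vertices.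
  closed-component : ∀ x xs (R : List (Edge k)) → Unique (x ∷ xs) →
    let L = (x , last x xs) ∷ trail x xs ++ R in
    MaxDegree≤2 L → Touched (x ∷ xs) L → Component (length R) L
  closed-component x xs R unq sub touched with reflection x xs unq
  ... | π , rev , πx , πl , fix = record
    { part       = (x , last x xs) ∷ trail x xs
    ; rest       = R
    ; decomposes = permute ↭-refl
    ; bounded    = ℕ.≤-refl
    ; reflect    = π
    ; reverses   = ↭-trans (↭-reflexive (cong (_∷ map (relabel π) (trail x xs)) (cong₂ _,_ πx πl))) (↭.prep _ rev)
    ; separates  = separates
    }
    where
    l = last x xs
    L = (x , l) ∷ trail x xs ++ R

    last∈ : ∀ x xs → last x xs ∈ x ∷ xs
    last∈ x []       = here refl
    last∈ x (y ∷ ys) = there (last∈ y ys)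

    separates : ∀ v → (π ⟨$⟩ʳ v ≡ v × δ v x + δ v l + deg v (trail x xs) ≡ 0) ⊎ (1 ≤ deg v L × deg v R ≡ 0)
    separates v with v ∈? (x ∷ xs)
    ... | yes v∈ = inj₂ (touched v∈ , saturated {deg v (trail x xs)} (deg-trail-∈ v∈)
                     (subst (λ d → δ v x + δ v l + d ≤ 2) (deg-++ v (trail x xs) R) (sub v)))
    ... | no v∉ = inj₁ (fix v v∉ , cong₂ _+_ (cong₂ _+_ (δ-≢ (v∉ ∘ here)) (δ-≢ λ { refl → v∉ (last∈ x xs) }))
                                             (deg-trail-∉ v∉))

  -- No remaining edge meets the trail, which is therefore a component that is a path.
  open-component : ∀ x xs (R : List (Edge k)) → Unique (x ∷ xs) →
    let L = trail x xs ++ R in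
    Touched (x ∷ xs) L → (∀ {v} → v ∈ x ∷ xs → deg v R ≡ 0) → Component (length R) L
  open-component x xs R unq touched free with reflection x xs unq
  ... | π , rev , _ , _ , fix = record
    { part       = trail x xs
    ; rest       = R
    ; decomposes = permute ↭-refl
    ; bounded    = ℕ.≤-refl
    ; reflect    = π
    ; reverses   = rev
    ; separates  = separates
    }
    where
    separates : ∀ v → (π ⟨$⟩ʳ v ≡ v × deg v (trail x xs) ≡ 0) ⊎ (1 ≤ deg v (trail x xs ++ R) × deg v R ≡ 0)
    separates v with v ∈? (x ∷ xs)
    ... | yes v∈ = inj₂ (touched v∈ , free v∈)
    ... | no v∉  = inj₁ (fix v v∉ , deg-trail-∉ v∉)

  -- Any other trail vertex would reach degree three through the new edge. The term for the first
  -- vertex in `deg-trail-∈` is matched by the end `x` of that edge, so the case of a loop at `x` is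
  -- covered.
  closing-vertex : ∀ {x y : Fin k} {xs R} → y ∈ x ∷ xs → deg y ((x , y) ∷ trail x xs ++ R) ≤ 2 → y ≡ last x xs
  closing-vertex {x = x} {y} {xs} {R} y∈ deg≤2 with y ≟ last x xs
  ... | yes y≡l = y≡l
  ... | no  y≢l = contradiction (begin
    3                                                    ≤⟨ s≤s (deg-trail-∈ y∈) ⟩
    1 + (deg y (trail x xs) + δ y x + δ y (last x xs))   ≡⟨ cong (λ d → 1 + (deg y (trail x xs) + δ y x + d)) (δ-≢ y≢l) ⟩
    1 + (deg y (trail x xs) + δ y x + 0)                 ≡⟨ cong (_+ (deg y (trail x xs) + δ y x + 0)) (δ-refl y) ⟨
    δ y y + (deg y (trail x xs) + δ y x + 0)             ≤⟨ ℕ.m≤m+n _ (deg y R) ⟩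
    δ y y + (deg y (trail x xs) + δ y x + 0) + deg y R   ≡⟨ regroup (δ y y) _ (δ y x) (deg y R) ⟩
    δ y x + δ y y + (deg y (trail x xs) + deg y R)       ≡⟨ cong (δ y x + δ y y +_) (deg-++ y (trail x xs) R) ⟨
    deg y ((x , y) ∷ trail x xs ++ R)                    ≤⟨ deg≤2 ⟩
    2                                                    ∎) (ℕ.<⇒≱ ℕ.≤-refl)
    where
    open ℕ.≤-Reasoning
    regroup : ∀ a t b r → a + (t + b + 0) + r ≡ b + a + (t + r)
    regroup = solve-∀

  -- An inner vertex has two edges of the trail already and cannot take a third.
  end-vertex : ∀ {x z y : Fin k} {xs R} → z ∈ x ∷ xs → deg z ((z , y) ∷ trail x xs ++ R) ≤ 2 →
               z ≡ x ⊎ z ≡ last x xs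
  end-vertex {x = x} {z} {y} {xs} {R} z∈ deg≤2 with z ≟ x | z ≟ last x xs
  ... | yes z≡x | _       = inj₁ z≡x
  ... | no _    | yes z≡l = inj₂ z≡l
  ... | no z≢x  | no z≢l  = contradiction (begin
    3                                                    ≤⟨ s≤s (deg-trail-∈ z∈) ⟩
    1 + (deg z (trail x xs) + δ z x + δ z (last x xs))   ≡⟨ cong₂ (λ a b → 1 + (deg z (trail x xs) + a + b)) (δ-≢ z≢x) (δ-≢ z≢l) ⟩
    1 + (deg z (trail x xs) + 0 + 0)                     ≡⟨ cong (_+ (deg z (trail x xs) + 0 + 0)) (δ-refl z) ⟨
    δ z z + (deg z (trail x xs) + 0 + 0)                 ≤⟨ ℕ.m≤m+n _ (δ z y + deg z R) ⟩
    δ z z + (deg z (trail x xs) + 0 + 0) + (δ z y + deg z R) ≡⟨ regroup (δ z z) (deg z (trail x xs)) (δ z y) (deg z R) ⟩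
    δ z z + δ z y + (deg z (trail x xs) + deg z R)       ≡⟨ cong (δ z z + δ z y +_) (deg-++ z (trail x xs) R) ⟨
    deg z ((z , y) ∷ trail x xs ++ R)                    ≤⟨ deg≤2 ⟩
    2                                                    ∎) (ℕ.<⇒≱ ℕ.≤-refl)
    where
    open ℕ.≤-Reasoning
    regroup : ∀ a t b r → a + (t + 0 + 0) + (b + r) ≡ a + b + (t + r)
    regroup = solve-∀

  MaxDegree≤2-~ : ∀ {L L′ : List (Edge k)} → L ~ L′ → MaxDegree≤2 L → MaxDegree≤2 L′
  MaxDegree≤2-~ p sub v = subst (_≤ 2) (deg-~ v p) (sub v)

  Touched-~ : ∀ {xs} {L L′ : List (Edge k)} → L ~ L′ → Touched xs L → Touched xs L′
  Touched-~ p touched {v} v∈ = subst (1 ≤_) (deg-~ v p) (touched v∈)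

  -- Mutual recursion: `grow` looks for an edge at the trail, and `extend` attaches it at the first
  -- vertex. The bound `m` on the number of remaining edges is the termination measure; it drops
  -- each time `grow` hands over an edge.
  extend : ∀ m x xs y (R : List (Edge k)) → length R ≤ m → Unique (x ∷ xs) →
    let L = (x , y) ∷ trail x xs ++ R in
    MaxDegree≤2 L → Touched (x ∷ xs) L → Component (length R) L

  grow : ∀ m x xs (R : List (Edge k)) → length R ≤ m → Unique (x ∷ xs) →
    let L = trail x xs ++ R in
    MaxDegree≤2 L → Touched (x ∷ xs) L → Component (length R) L

  extend m x xs y R R≤m unq sub touched with y ∈? (x ∷ xs)
  ... | yes y∈ with refl ← closing-vertex {xs = xs} {R} y∈ (sub y) = closed-component x xs R unq sub touched
  -- The new vertex `y` becomes the first one, so the edge must run from `y` to `x`.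
  ... | no y∉ = Component-~ ℕ.≤-refl (reorient x y (trail x xs ++ R))
    (grow m y (x ∷ xs) R R≤m (All.¬Any⇒All¬ _ y∉ ∷ unq) (MaxDegree≤2-~ (reorient x y (trail x xs ++ R)) sub) touched′)
    where
    touched′ : Touched (y ∷ x ∷ xs) ((y , x) ∷ trail x xs ++ R)
    touched′ (here refl) = ℕ.≤-trans (ℕ.≤-reflexive (sym (δ-refl y)))
                               (ℕ.≤-trans (ℕ.m≤m+n (δ y y) (δ y x)) (ℕ.m≤m+n _ _))
    touched′ (there v∈)    = Touched-~ {xs = x ∷ xs} (reorient x y (trail x xs ++ R)) touched v∈

  grow m x xs R R≤m unq sub touched with incident-edge (x ∷ xs) R
  ... | inj₁ free = open-component x xs R unq touched free
  ... | inj₂ (z , y , R′ , z∈ , R~) = go m (subst (_≤ m) (~-length R~) R≤m)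
    where
    L~ : trail x xs ++ R ~ (z , y) ∷ trail x xs ++ R′
    L~ = ~-trans (~-++ˡ (trail x xs) R~) (permute (↭ₚ.shift (z , y) (trail x xs) R′))

    smaller : length R′ ≤ length R
    smaller = ℕ.≤-trans (ℕ.n≤1+n _) (ℕ.≤-reflexive (sym (~-length R~)))

    go : ∀ m → suc (length R′) ≤ m → Component (length R) (trail x xs ++ R)
    go (suc m) (s≤s R′≤m) with end-vertex {xs = xs} {R = R′} z∈ (MaxDegree≤2-~ L~ sub z)
    ... | inj₁ refl = Component-~ smaller L~
      (extend m x xs y R′ R′≤m unq (MaxDegree≤2-~ L~ sub) (Touched-~ {xs = x ∷ xs} L~ touched))
    -- The edge is attached at the last vertex, so the trail is reversed to bring that vertex to the
    -- front.
    ... | inj₂ refl with ys , rev , _ , perm ← reverse-trail x xs = Component-~ smaller L~ʳ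
      (extend m z ys y R′ R′≤m (Unique-↭ (↭-sym xs↭) unq) (MaxDegree≤2-~ L~ʳ sub)
         (Touched-~ {xs = z ∷ ys} L~ʳ (touched ∘ ↭ₚ.∈-resp-↭ xs↭)))
      where
      xs↭ : z ∷ ys ↭ x ∷ xs
      xs↭ = ↭-trans (↭-reflexive (sym rev)) (↭ₚ.↭-reverse (x ∷ xs))

      trail~ : trail x xs ~ trail z ys
      trail~ = ~-trans (~-opposite (trail x xs)) (permute (↭-sym perm))

      L~ʳ : trail x xs ++ R ~ (z , y) ∷ trail z ys ++ R′
      L~ʳ = ~-trans L~ (~-++ˡ ((z , y) ∷ []) (~-++ʳ R′ trail~))

  component : ∀ e (R : List (Edge k)) → MaxDegree≤2 (e ∷ R) → Component (length R) (e ∷ R)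
  -- The trail starts as the single vertex `x`, with the given edge as its first extension.
  component (x , y) R sub = extend (length R) x [] y R ℕ.≤-refl ([] ∷ []) sub
    λ { (here refl) → ℕ.≤-trans (ℕ.≤-reflexive (sym (δ-refl x))) (ℕ.≤-trans (ℕ.m≤m+n (δ x x) (δ x y)) (ℕ.m≤m+n _ _)) }

  -- Vanishing on edge lists of odd length

  sgn : List (Edge k) → ℤ
  sgn L = -1ℤ ℤ.^ length L

  sgn-++ : ∀ (L M : List (Edge k)) → sgn (L ++ M) ≡ sgn L ℤ.* sgn M
  sgn-++ L M = trans (cong (-1ℤ ℤ.^_) (List.length-++ L)) (ℤ.^-distribˡ-+-* -1ℤ (length L) (length M))

  sgn-values : ∀ (L : List (Edge k)) → sgn L ≡ 1ℤ ⊎ sgn L ≡ -1ℤ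
  sgn-values []      = inj₁ refl
  sgn-values (_ ∷ L) with sgn-values L
  ... | inj₁ eq = inj₂ (cong (-1ℤ ℤ.*_) eq)
  ... | inj₂ eq = inj₁ (cong (-1ℤ ℤ.*_) eq)

  ≡-neg⇒≡0 : ∀ {i} → i ≡ ℤ.- i → i ≡ 0ℤ
  ≡-neg⇒≡0 {ℤ.+0} _ = refl

  module _ {W : List (Edge k) → ℤ} (alternating : Alternating W) where
    open Alternating alternating

    -- A reorientation only changes the sign of `W`, which vanishing does not see.
    W-~ : ∀ {L L′} → L ~ L′ → W L′ ≡ 0ℤ → W L ≡ 0ℤ
    W-~ (reorient i j L)  eq = trans (W-flip i j L) (cong ℤ.-_ eq)
    W-~ (permute p)   eq = trans (W-↭ p) eq
    W-~ (~-trans p q) eq = W-~ p (W-~ q eq)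

    W-opposite : ∀ P R → W (map opposite P ++ R) ≡ sgn P ℤ.* W (P ++ R)
    W-opposite []            R = sym (ℤ.*-identityˡ _)
    W-opposite ((i , j) ∷ P) R = begin
      W ((j , i) ∷ map opposite P ++ R)        ≡⟨ W-flip j i _ ⟩
      ℤ.- W ((i , j) ∷ map opposite P ++ R)    ≡⟨ cong ℤ.-_ (W-↭ (↭ₚ.shift (i , j) (map opposite P) R)) ⟨
      ℤ.- W (map opposite P ++ (i , j) ∷ R)    ≡⟨ cong ℤ.-_ (W-opposite P ((i , j) ∷ R)) ⟩
      ℤ.- (sgn P ℤ.* W (P ++ (i , j) ∷ R))     ≡⟨ cong (λ w → ℤ.- (sgn P ℤ.* w)) (W-↭ (↭ₚ.shift (i , j) P R)) ⟩
      ℤ.- (sgn P ℤ.* W ((i , j) ∷ P ++ R))     ≡⟨ ℤ.neg-distribˡ-* (sgn P) _ ⟩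
      (ℤ.- sgn P) ℤ.* W ((i , j) ∷ P ++ R)     ≡⟨ cong (ℤ._* W ((i , j) ∷ P ++ R)) (ℤ.-1*i≡-i (sgn P)) ⟨
      sgn ((i , j) ∷ P) ℤ.* W ((i , j) ∷ P ++ R) ∎
      where open ≡-Reasoning

    -- Relabelling by `π` preserves `W`, leaves `M` alone and turns round each of the oddly many
    -- edges of `P`, so the value equals its own negative.
    odd-component-vanishes : ∀ π P M → map (relabel π) P ↭ map opposite P →
      (∀ v → π ⟨$⟩ʳ v ≡ v ⊎ deg v M ≡ 0) → sgn P ≡ -1ℤ → W (P ++ M) ≡ 0ℤ
    odd-component-vanishes π P M rev fix odd = ≡-neg⇒≡0 (begin
      W (P ++ M)                                    ≡⟨ W-relabel π (P ++ M) ⟨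
      W (map (relabel π) (P ++ M))                  ≡⟨ cong W (List.map-++ (relabel π) P M) ⟩
      W (map (relabel π) P ++ map (relabel π) M)    ≡⟨ cong (λ N → W (map (relabel π) P ++ N)) (relabel-fixes π M fix) ⟩
      W (map (relabel π) P ++ M)                    ≡⟨ W-↭ (↭ₚ.++⁺ʳ M rev) ⟩
      W (map opposite P ++ M)                       ≡⟨ W-opposite P M ⟩
      sgn P ℤ.* W (P ++ M)                          ≡⟨ cong (ℤ._* W (P ++ M)) odd ⟩
      -1ℤ ℤ.* W (P ++ M)                            ≡⟨ ℤ.-1*i≡-i _ ⟩
      ℤ.- W (P ++ M)                                ∎)
      where open ≡-Reasoning

    -- C collects the even components already split off.
    odd-vanishes-beside : ∀ m C L → length L ≤ m → MaxDegree≤2 L → (∀ v → 1 ≤ deg v L → deg v C ≡ 0) →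
                          sgn L ≡ -1ℤ → W (C ++ L) ≡ 0ℤ
    -- The empty list has sign 1, so `odd` guarantees a first edge, and its component is split off.
    odd-vanishes-beside (suc m) C (e ∷ R₀) (s≤s R₀≤m) sub disjoint odd =
      W-~ (~-++ˡ C decomposes) split
      where
      open Component (component e R₀ sub)
      L = e ∷ R₀

      deg-parts : ∀ v → deg v L ≡ deg v part + deg v rest
      deg-parts v = trans (deg-~ v decomposes) (deg-++ v part rest)

      rest≤L : ∀ v → deg v rest ≤ deg v L
      rest≤L v = subst (deg v rest ≤_) (sym (deg-parts v)) (ℕ.m≤n+m _ _)

      -- A vertex moved by the reflection has an edge in `L`, hence none in `C`, and it has none in
      -- `rest` either.
      fixes : ∀ v → reflect ⟨$⟩ʳ v ≡ v ⊎ deg v (C ++ rest) ≡ 0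
      fixes v with separates v
      ... | inj₁ (eq , _) = inj₁ eq
      ... | inj₂ (v∈L , free) = inj₂ (trans (deg-++ v C rest) (cong₂ _+_ (disjoint v v∈L) free))

      disjoint′ : ∀ v → 1 ≤ deg v rest → deg v (C ++ part) ≡ 0
      disjoint′ v v∈ with separates v
      ... | inj₁ (_ , free) = trans (deg-++ v C part) (cong₂ _+_ (disjoint v (ℕ.≤-trans v∈ (rest≤L v))) free)
      ... | inj₂ (_ , free) with () ← subst (1 ≤_) free v∈

      split : W (C ++ part ++ rest) ≡ 0ℤ
      split with sgn-values part
      ... | inj₂ part-odd = trans (W-↭ (↭ₚ.shifts C part))
        (odd-component-vanishes reflect part (C ++ rest) reverses fixes part-odd)
      -- An even part is moved over to `C`; by multiplicativity of the sign `rest` is still odd.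
      ... | inj₁ part-even = trans (cong W (sym (List.++-assoc C part rest)))
        (odd-vanishes-beside m (C ++ part) rest (ℕ.≤-trans bounded R₀≤m)
          (λ v → ℕ.≤-trans (rest≤L v) (sub v)) disjoint′ (begin
            sgn rest               ≡⟨ ℤ.*-identityˡ _ ⟨
            1ℤ ℤ.* sgn rest        ≡⟨ cong (ℤ._* sgn rest) part-even ⟨
            sgn part ℤ.* sgn rest  ≡⟨ sgn-++ part rest ⟨
            sgn (part ++ rest)     ≡⟨ cong (-1ℤ ℤ.^_) (~-length decomposes) ⟨
            sgn L                  ≡⟨ odd ⟩
            -1ℤ                    ∎))
        where open ≡-Reasoning

    odd-vanishes : ∀ L → MaxDegree≤2 L → sgn L ≡ -1ℤ → W L ≡ 0ℤ
    odd-vanishes L sub = odd-vanishes-beside (length L) [] L ℕ.≤-refl sub λ _ _ → refl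

open Trails
open import Data.Integer.Base using (_+_; _*_; -_; _-_) renaming (+_ to pos)
open import Data.Integer.Tactic.RingSolver using (solve-∀)
open ≡-Reasoning

-- Finite sums

-- The Iverson bracket.
⟦_⟧ : Dec P → ℤ
⟦ yes _ ⟧ = 1ℤ
⟦ no  _ ⟧ = 0ℤ

⟦⟧-yes : (d : Dec P) → P → ⟦ d ⟧ ≡ 1ℤ
⟦⟧-yes (yes _) p = refl
⟦⟧-yes (no ¬p) p = contradiction p ¬p

⟦⟧-no : (d : Dec P) → ¬ P → ⟦ d ⟧ ≡ 0ℤ
⟦⟧-no (yes p) ¬p = contradiction p ¬p
⟦⟧-no (no _)  ¬p = refl

⟦⟧-⇔ : (d : Dec P) (e : Dec Q) → (P → Q) → (Q → P) → ⟦ d ⟧ ≡ ⟦ e ⟧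
⟦⟧-⇔ (yes p) e f g = sym (⟦⟧-yes e (f p))
⟦⟧-⇔ (no ¬p) e f g = sym (⟦⟧-no e (¬p ∘ g))

⟦⟧-× : (d : Dec P) (e : Dec Q) → ⟦ d ×-dec e ⟧ ≡ ⟦ d ⟧ * ⟦ e ⟧
⟦⟧-× (yes p) (yes q) = refl
⟦⟧-× (yes p) (no ¬q) = refl
⟦⟧-× (no ¬p) e       = refl

⟦⟧-mono : (d : Dec P) (e : Dec Q) → (P → Q) → ⟦ d ⟧ ℤ.≤ ⟦ e ⟧
⟦⟧-mono (yes p) e       f = ℤ.≤-reflexive (sym (⟦⟧-yes e (f p)))
⟦⟧-mono (no ¬p) (yes _) f = +≤+ z≤n
⟦⟧-mono (no ¬p) (no _)  f = +≤+ z≤n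

∑ : List A → (A → ℤ) → ℤ
∑ []       f = 0ℤ
∑ (x ∷ xs) f = f x + ∑ xs f

∑-cong : ∀ (xs : List A) {f g} → (∀ x → f x ≡ g x) → ∑ xs f ≡ ∑ xs g
∑-cong []       f≗g = refl
∑-cong (x ∷ xs) f≗g = cong₂ _+_ (f≗g x) (∑-cong xs f≗g)

∑-mono : ∀ (xs : List A) {f g} → (∀ x → f x ℤ.≤ g x) → ∑ xs f ℤ.≤ ∑ xs g
∑-mono []       f≤g = ℤ.≤-refl
∑-mono (x ∷ xs) f≤g = ℤ.+-mono-≤ (f≤g x) (∑-mono xs f≤g)

∑-zero : ∀ (xs : List A) → ∑ xs (λ _ → 0ℤ) ≡ 0ℤ
∑-zero []       = refl
∑-zero (x ∷ xs) = trans (ℤ.+-identityˡ _) (∑-zero xs)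

∑-+ : ∀ (xs : List A) (f g : A → ℤ) → ∑ xs (λ x → f x + g x) ≡ ∑ xs f + ∑ xs g
∑-+ []       f g = refl
∑-+ (x ∷ xs) f g = trans (cong (f x + g x +_) (∑-+ xs f g)) (interchange (f x) (g x) _ _)
  where
  interchange : ∀ a b c d → a + b + (c + d) ≡ a + c + (b + d)
  interchange = solve-∀

∑-*ˡ : ∀ (xs : List A) c (f : A → ℤ) → ∑ xs (λ x → c * f x) ≡ c * ∑ xs f
∑-*ˡ []       c f = sym (ℤ.*-zeroʳ c)
∑-*ˡ (x ∷ xs) c f = trans (cong (c * f x +_) (∑-*ˡ xs c f)) (sym (ℤ.*-distribˡ-+ c (f x) _))

∑-*ʳ : ∀ (xs : List A) c (f : A → ℤ) → ∑ xs (λ x → f x * c) ≡ ∑ xs f * c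
∑-*ʳ xs c f = begin
  ∑ xs (λ x → f x * c) ≡⟨ ∑-cong xs (λ x → ℤ.*-comm (f x) c) ⟩
  ∑ xs (λ x → c * f x) ≡⟨ ∑-*ˡ xs c f ⟩
  c * ∑ xs f           ≡⟨ ℤ.*-comm c _ ⟩
  ∑ xs f * c           ∎

∑-swap : ∀ (xs : List A) (ys : List B) (f : A → B → ℤ) →
         ∑ xs (λ x → ∑ ys (λ y → f x y)) ≡ ∑ ys (λ y → ∑ xs (λ x → f x y))
∑-swap []       ys f = sym (∑-zero ys)
∑-swap (x ∷ xs) ys f = trans (cong (∑ ys (f x) +_) (∑-swap xs ys f)) (sym (∑-+ ys _ _))

∑-++ : ∀ (xs ys : List A) f → ∑ (xs ++ ys) f ≡ ∑ xs f + ∑ ys f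
∑-++ []       ys f = sym (ℤ.+-identityˡ _)
∑-++ (x ∷ xs) ys f = trans (cong (f x +_) (∑-++ xs ys f)) (sym (ℤ.+-assoc (f x) _ _))

∑-map : ∀ (h : A → B) xs f → ∑ (map h xs) f ≡ ∑ xs (f ∘ h)
∑-map h []       f = refl
∑-map h (x ∷ xs) f = cong (f (h x) +_) (∑-map h xs f)

∑-cartesianProductWith : ∀ (h : A → B → C) xs ys (f : C → ℤ) →
  ∑ (cartesianProductWith h xs ys) f ≡ ∑ xs (λ x → ∑ ys (λ y → f (h x y)))
∑-cartesianProductWith h []       ys f = refl
∑-cartesianProductWith h (x ∷ xs) ys f = begin
  ∑ (map (h x) ys ++ cartesianProductWith h xs ys) f       ≡⟨ ∑-++ (map (h x) ys) _ f ⟩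
  ∑ (map (h x) ys) f + ∑ (cartesianProductWith h xs ys) f  ≡⟨ cong₂ _+_ (∑-map (h x) ys f) (∑-cartesianProductWith h xs ys f) ⟩
  ∑ (x ∷ xs) (λ x → ∑ ys (λ y → f (h x y)))                ∎

∑-filter : ∀ {P : A → Set} (P? : Decidable P) xs f →
           ∑ (filter P? xs) f ≡ ∑ xs (λ x → ⟦ P? x ⟧ * f x)
∑-filter P? []       f = refl
∑-filter P? (x ∷ xs) f with P? x
... | yes _ = cong₂ _+_ (sym (ℤ.*-identityˡ (f x))) (∑-filter P? xs f)
... | no  _ = trans (∑-filter P? xs f) (sym (ℤ.+-identityˡ _))

length-∑ : ∀ (xs : List A) → pos (length xs) ≡ ∑ xs (λ _ → 1ℤ)
length-∑ []       = refl
length-∑ (x ∷ xs) = cong (1ℤ +_) (length-∑ xs)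

length-filter-∑ : ∀ {P : A → Set} (P? : Decidable P) xs →
                  pos (length (filter P? xs)) ≡ ∑ xs (λ x → ⟦ P? x ⟧)
length-filter-∑ P? xs = begin
  pos (length (filter P? xs))         ≡⟨ length-∑ (filter P? xs) ⟩
  ∑ (filter P? xs) (λ _ → 1ℤ)     ≡⟨ ∑-filter P? xs _ ⟩
  ∑ xs (λ x → ⟦ P? x ⟧ * 1ℤ)      ≡⟨ ∑-cong xs (λ x → ℤ.*-identityʳ _) ⟩
  ∑ xs (λ x → ⟦ P? x ⟧)           ∎

-- That each element is listed exactly once is expressed as a sum of indicators, the form in which
-- double counting uses it.
record Enumerates (_≟ᴬ_ : DecidableEquality A) (xs : List A) : Set where
  constructor enumerates
  field
    once : ∀ a → ∑ xs (λ x → ⟦ x ≟ᴬ a ⟧) ≡ 1ℤ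

open Enumerates

module _ {_≟ᴬ_ : DecidableEquality A} {xs : List A} (enum : Enumerates _≟ᴬ_ xs) where

  ∑-unique : ∀ {P : A → Set} (P? : Decidable P) a → P a → (∀ {x} → P x → x ≡ a) →
             ∑ xs (λ x → ⟦ P? x ⟧) ≡ 1ℤ
  ∑-unique {P} P? a pa uniq =
    trans (∑-cong xs λ x → ⟦⟧-⇔ (P? x) (x ≟ᴬ a) uniq λ x≡a → subst P (sym x≡a) pa) (once enum a)

  ∑-sift : ∀ a (F : A → ℤ) → ∑ xs (λ x → ⟦ x ≟ᴬ a ⟧ * F x) ≡ F a
  ∑-sift a F = begin
    ∑ xs (λ x → ⟦ x ≟ᴬ a ⟧ * F x)  ≡⟨ ∑-cong xs step ⟩
    ∑ xs (λ x → ⟦ x ≟ᴬ a ⟧ * F a)  ≡⟨ ∑-*ʳ xs (F a) _ ⟩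
    ∑ xs (λ x → ⟦ x ≟ᴬ a ⟧) * F a  ≡⟨ cong (_* F a) (once enum a) ⟩
    1ℤ * F a                       ≡⟨ ℤ.*-identityˡ (F a) ⟩
    F a                            ∎
    where
    step : ∀ x → ⟦ x ≟ᴬ a ⟧ * F x ≡ ⟦ x ≟ᴬ a ⟧ * F a
    step x with x ≟ᴬ a
    ... | yes refl = refl
    ... | no  _    = refl

  ∑-positive : ∀ {P : A → Set} (P? : Decidable P) a → P a → 1ℤ ℤ.≤ ∑ xs (λ x → ⟦ P? x ⟧)
  ∑-positive {P} P? a pa = subst (ℤ._≤ _) (once enum a)
    (∑-mono xs λ x → ⟦⟧-mono (x ≟ᴬ a) (P? x) λ x≡a → subst P (sym x≡a) pa)

module _ {_≟ᴬ_ : DecidableEquality A} {xs : List A} (enumA : Enumerates _≟ᴬ_ xs)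
         {_≟ᴮ_ : DecidableEquality B} {ys : List B} (enumB : Enumerates _≟ᴮ_ ys) where

  -- Write `F (φ y)` as a sum over `x` with the indicator of `x = φ y` and exchange the sums: the
  -- only `y` over a given `x` is `ψ x`.
  ∑-reindex : ∀ (φ : B → A) (ψ : A → B) → (∀ a → φ (ψ a) ≡ a) → (∀ b → ψ (φ b) ≡ b) →
              ∀ (F : A → ℤ) → ∑ ys (F ∘ φ) ≡ ∑ xs F
  ∑-reindex φ ψ φψ ψφ F = begin
    ∑ ys (F ∘ φ)
      ≡⟨ ∑-cong ys (λ y → ∑-sift enumA (φ y) F) ⟨
    ∑ ys (λ y → ∑ xs (λ x → ⟦ x ≟ᴬ φ y ⟧ * F x))
      ≡⟨ ∑-swap ys xs _ ⟩
    ∑ xs (λ x → ∑ ys (λ y → ⟦ x ≟ᴬ φ y ⟧ * F x))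
      ≡⟨ ∑-cong xs (λ x → ∑-*ʳ ys (F x) _) ⟩
    ∑ xs (λ x → ∑ ys (λ y → ⟦ x ≟ᴬ φ y ⟧) * F x)
      ≡⟨ ∑-cong xs (λ x → cong (_* F x)
           (∑-unique enumB (λ y → x ≟ᴬ φ y) (ψ x) (sym (φψ x)) λ {y} x≡φy → trans (sym (ψφ y)) (cong ψ (sym x≡φy)))) ⟩
    ∑ xs (λ x → 1ℤ * F x)
      ≡⟨ ∑-cong xs (λ x → ℤ.*-identityˡ (F x)) ⟩
    ∑ xs F ∎

  -- As `h` is injective, the indicator of a value of `h` factors into those of its two arguments.
  enumerates-product : {_≟ᶜ_ : DecidableEquality C} (h : A → B → C) →
    (∀ {a b a′ b′} → h a b ≡ h a′ b′ → a ≡ a′ × b ≡ b′) →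
    (∀ c → ∃ λ a → ∃ λ b → h a b ≡ c) →
    Enumerates _≟ᶜ_ (cartesianProductWith h xs ys)
  once (enumerates-product {_≟ᶜ_ = _≟ᶜ_} h h-injective h-surjective) c with h-surjective c
  ... | a , b , refl = begin
    ∑ (cartesianProductWith h xs ys) (λ z → ⟦ z ≟ᶜ h a b ⟧)
      ≡⟨ ∑-cartesianProductWith h xs ys _ ⟩
    ∑ xs (λ x → ∑ ys (λ y → ⟦ h x y ≟ᶜ h a b ⟧))
      ≡⟨ ∑-cong xs (λ x → ∑-cong ys λ y →
           trans (⟦⟧-⇔ (h x y ≟ᶜ h a b) (x ≟ᴬ a ×-dec y ≟ᴮ b) h-injective λ { (refl , refl) → refl })
                 (⟦⟧-× (x ≟ᴬ a) (y ≟ᴮ b))) ⟩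
    ∑ xs (λ x → ∑ ys (λ y → ⟦ x ≟ᴬ a ⟧ * ⟦ y ≟ᴮ b ⟧))
      ≡⟨ ∑-cong xs (λ x → trans (∑-*ˡ ys ⟦ x ≟ᴬ a ⟧ _) (cong (⟦ x ≟ᴬ a ⟧ *_) (once enumB b))) ⟩
    ∑ xs (λ x → ⟦ x ≟ᴬ a ⟧ * 1ℤ)
      ≡⟨ ∑-sift enumA a (λ _ → 1ℤ) ⟩
    1ℤ ∎

∑-tabulate : ∀ (h : Fin n → A) (f : A → ℤ) → ∑ (List.tabulate h) f ≡ ∑ (allFin n) (f ∘ h)
∑-tabulate {n = zero}  h f = refl
∑-tabulate {n = suc n} h f = cong (f (h zero) +_)
  (trans (∑-tabulate (h ∘ suc) f) (sym (∑-tabulate {n = n} suc (f ∘ h))))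

enumerates-allFin : ∀ n → Enumerates _≟_ (allFin n)
once (enumerates-allFin (suc n)) a = trans (cong (⟦ zero ≟ a ⟧ +_) (∑-tabulate {n = n} suc λ x → ⟦ x ≟ a ⟧)) (split a)
  where
  split : ∀ a → ⟦ zero ≟ a ⟧ + ∑ (allFin n) (λ i → ⟦ suc i ≟ a ⟧) ≡ 1ℤ
  split zero    = cong (1ℤ +_) (trans (∑-cong (allFin n) (λ i → ⟦⟧-no (suc i ≟ zero) λ ())) (∑-zero (allFin n)))
  split (suc a) = trans (ℤ.+-identityˡ _)
    (∑-unique (enumerates-allFin n) (λ i → suc i ≟ suc a) a refl suc-injective)

enumerates-allVecs : ∀ {_≟ᴬ_ : DecidableEquality A} {xs} → Enumerates _≟ᴬ_ xs →
                     ∀ n → Enumerates (Vec.≡-dec _≟ᴬ_) (allVecs xs n)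
once (enumerates-allVecs enum zero) [] = refl
enumerates-allVecs enum (suc n) = enumerates-product enum (enumerates-allVecs enum n) _∷_
  Vec.∷-injective λ { (x ∷ v) → x , v , refl }

_≟ˢ_ : DecidableEquality (Subset n)
_≟ˢ_ = Vec.≡-dec Bool._≟_

enumerates-allSubsets : ∀ n → Enumerates _≟ˢ_ (allSubsets n)
enumerates-allSubsets n = enumerates-allVecs (enumerates λ { outside → refl ; inside → refl }) n

_≟ᵛᵃ_ : DecidableEquality (VertexArcSets n)
mkSets U O ≟ᵛᵃ mkSets U′ O′ with U ≟ˢ U′ | Vec.≡-dec _≟ˢ_ O O′
... | yes refl | yes refl = yes refl
... | no U≢U′  | _        = no λ { refl → U≢U′ refl }
... | yes _    | no O≢O′  = no λ { refl → O≢O′ refl }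

enumerates-allVertexArcSets : ∀ n → Enumerates _≟ᵛᵃ_ (allVertexArcSets n)
enumerates-allVertexArcSets n =
  enumerates-product (enumerates-allSubsets n) (enumerates-allVecs (enumerates-allSubsets n) n) mkSets
    (λ { refl → refl , refl }) λ { (mkSets U O) → U , O , refl }

-- Copies and embeddings

-- The tool for double counting: `R` has at most one solution, and it has one exactly when `P`
-- holds.
∑-fibre : ∀ {_≟ᴮ_ : DecidableEquality B} {ys} → Enumerates _≟ᴮ_ ys →
          ∀ {R : B → Set} (P? : Dec P) (R? : Decidable R) →
          (P → ∃ R) → (∀ {b} → R b → P) → (∀ {b b′} → R b → R b′ → b ≡ b′) →
          ∑ ys (λ b → ⟦ R? b ⟧) ≡ ⟦ P? ⟧
∑-fibre enum (yes p) R? exists sound unique =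
  let b , r = exists p in ∑-unique enum R? b r λ r′ → unique r′ r
∑-fibre {ys = ys} enum (no ¬p) R? exists sound unique =
  trans (∑-cong ys λ b → ⟦⟧-no (R? b) (¬p ∘ sound)) (∑-zero ys)

enumerates-maps : ∀ k n → Enumerates (Vec.≡-dec _≟_) (allVecs (allFin n) k)
enumerates-maps k n = enumerates-allVecs (enumerates-allFin n) k

subsetOf : {P : Fin n → Set} → Decidable P → Subset n
subsetOf P? = tabulate (λ i → does (P? i))

∈-subsetOf⁺ : ∀ {P : Fin n → Set} (P? : Decidable P) {i} → P i → i Subset.∈ subsetOf P?
∈-subsetOf⁺ P? {i} p = Vec.lookup⇒[]= i _ (trans (Vec.lookup∘tabulate _ i) (dec-true (P? i) p))

∈-subsetOf⁻ : ∀ {P : Fin n → Set} (P? : Decidable P) {i} → i Subset.∈ subsetOf P? → P i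
∈-subsetOf⁻ P? {i} i∈ with P? i | trans (sym (Vec.lookup∘tabulate (λ i → does (P? i)) i)) (Vec.[]=⇒lookup i∈)
... | yes p | _ = p

mkSets-ext : ∀ {S S′ : VertexArcSets n} →
  (∀ {v} → v Subset.∈ vertices S → v Subset.∈ vertices S′) → (∀ {v} → v Subset.∈ vertices S′ → v Subset.∈ vertices S) →
  (∀ {u v} → HasArc S u v → HasArc S′ u v) → (∀ {u v} → HasArc S′ u v → HasArc S u v) →
  S ≡ S′
mkSets-ext {S = S} {S′} V⊆ V⊇ A⊆ A⊇ = cong₂ mkSets (⊆-antisym V⊆ V⊇) (begin
  out S                    ≡⟨ Vec.tabulate∘lookup (out S) ⟨
  tabulate (lookup (out S))  ≡⟨ Vec.tabulate-cong (λ u → ⊆-antisym (A⊆ {u}) (A⊇ {u})) ⟩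
  tabulate (lookup (out S′)) ≡⟨ Vec.tabulate∘lookup (out S′) ⟩
  out S′                   ∎)

lookup-injective : ∀ {xs ys : Vec A n} → (∀ i → lookup xs i ≡ lookup ys i) → xs ≡ ys
lookup-injective {xs = xs} {ys} eq =
  trans (sym (Vec.tabulate∘lookup xs)) (trans (Vec.tabulate-cong eq) (Vec.tabulate∘lookup ys))

Injective : (Fin k → Fin n) → Set
Injective f = ∀ i j → f i ≡ f j → i ≡ j

injective? : Decidable (Injective {k} {n})
injective? f = all? λ i → all? λ j → f i ≟ f j →-dec i ≟ j

module _ (H : Digraph (Fin k)) where
  open Digraph H using (Arc; arc?)

  IsAut : (Fin k → Fin k) → Set
  IsAut α = Injective α
          × (∀ i → ∃ λ j → α j ≡ i)
          × (∀ i j → Arc i j ⇔ Arc (α i) (α j))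

  isAut? : Decidable IsAut
  isAut? α = injective? α
       ×-dec (all? λ i → any? λ j → α j ≟ i)
       ×-dec (all? λ i → all? λ j → arc? i j ⇔-dec arc? (α i) (α j))

  #aut : ℤ
  #aut = ∑ (allVecs (allFin k) k) λ α → ⟦ isAut? (lookup α) ⟧

  -- The identity is an automorphism. Positivity allows `#aut` to be cancelled.
  1≤#aut : 1ℤ ℤ.≤ #aut
  1≤#aut = ∑-positive (enumerates-maps k k) (λ α → isAut? (lookup α)) (Vec.allFin k)
    ( (λ i j eq → trans (sym (Vec.lookup-allFin i)) (trans eq (Vec.lookup-allFin j)))
    , (λ i → i , Vec.lookup-allFin i)
    , (λ i j → subst₂ (λ x y → Arc i j ⇔ Arc x y) (sym (Vec.lookup-allFin i)) (sym (Vec.lookup-allFin j))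
                 (mk⇔ id id)))

  module _ (S : VertexArcSets n) {g : Fin k → Fin n} (g-iso : IsIso H S g) where

    private
      Factors : Vec (Fin n) k → Vec (Fin k) k → Set
      Factors f α = IsIso H S (lookup f) × (∀ i → lookup f i ≡ g (lookup α i))

      factors? : ∀ f α → Dec (Factors f α)
      factors? f α = isIso? H S (lookup f) ×-dec (all? λ i → lookup f i ≟ g (lookup α i))

      g-inj  = proj₁ (proj₂ (proj₂ g-iso))
      g-onto = proj₁ (proj₂ g-iso)
      g-arcs = proj₂ (proj₂ (proj₂ g-iso))

      factor : ∀ f → IsIso H S (lookup f) → ∃ (Factors f)
      factor f iso@(into , _) = tabulate α , iso , λ i →
        sym (trans (cong g (Vec.lookup∘tabulate α i)) (proj₂ (g-onto _ (into i))))
        where α = λ i → proj₁ (g-onto _ (into i))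

      factor-unique : ∀ f {α β} → Factors f α → Factors f β → α ≡ β
      factor-unique _ (_ , p) (_ , q) = lookup-injective λ i → g-inj _ _ (trans (sym (p i)) (q i))

      factor-aut : ∀ f α → Factors f α → IsAut (lookup α)
      factor-aut _ _ (iso , p) with (into , onto , inj , arcs) ← IsIso-resp H S p iso =
          (λ i j eq → inj i j (cong g eq))
        , (λ i → let j , eq = onto (g i) (proj₁ g-iso i) in j , g-inj _ _ eq)
        , (λ i j → mk⇔
            (Equivalence.from (g-arcs _ _) ∘ Equivalence.to (arcs i j))
            (Equivalence.from (arcs i j) ∘ Equivalence.to (g-arcs _ _)))

      compose : ∀ α → IsAut (lookup α) → ∃ λ f → Factors f α
      compose α (inj , onto , arcs) = tabulate gα , IsIso-resp H S (λ i → sym (Vec.lookup∘tabulate gα i))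
        ( (λ i → proj₁ g-iso (lookup α i))
        , (λ v v∈S → let i , gi≡v = g-onto v v∈S
                         j , αj≡i = onto i
                     in j , trans (cong g αj≡i) gi≡v)
        , (λ i j eq → inj i j (g-inj _ _ eq))
        , (λ i j → mk⇔
            (Equivalence.to (g-arcs _ _) ∘ Equivalence.to (arcs i j))
            (Equivalence.from (arcs i j) ∘ Equivalence.from (g-arcs _ _))) )
        , Vec.lookup∘tabulate gα
        where gα = λ i → g (lookup α i)

    -- With `g` fixed, the equation `f = g ∘ α` matches isomorphisms `f` with automorphisms `α`; the
    -- matched pairs are counted in both orders.
    #iso≡#aut : ∑ (allVecs (allFin n) k) (λ f → ⟦ isIso? H S (lookup f) ⟧) ≡ #aut
    #iso≡#aut = begin
      ∑ fs (λ f → ⟦ isIso? H S (lookup f) ⟧)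
        ≡⟨ ∑-cong fs (λ f → ∑-fibre (enumerates-maps k k) (isIso? H S (lookup f)) (factors? f)
             (factor f) proj₁ (factor-unique f)) ⟨
      ∑ fs (λ f → ∑ αs (λ α → ⟦ factors? f α ⟧))
        ≡⟨ ∑-swap fs αs _ ⟩
      ∑ αs (λ α → ∑ fs (λ f → ⟦ factors? f α ⟧))
        ≡⟨ ∑-cong αs (λ α → ∑-fibre (enumerates-maps k n) (isAut? (lookup α)) (λ f → factors? f α)
             (compose α) (λ {f} → factor-aut f α) λ { (_ , p) (_ , q) → lookup-injective λ i → trans (p i) (sym (q i)) }) ⟩
      #aut ∎
      where
      fs = allVecs (allFin n) k
      αs = allVecs (allFin k) k

  module _ (D : Digraph (Fin n)) where

    -- Arcs are preserved but not reflected, since copies need not be induced.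
    IsEmbedding : (Fin k → Fin n) → Set
    IsEmbedding f = Injective f
                  × (∀ i j → Arc i j → Digraph.Arc D (f i) (f j))

    isEmbedding? : Decidable IsEmbedding
    isEmbedding? f = injective? f
               ×-dec (all? λ i → all? λ j → arc? i j →-dec Digraph.arc? D (f i) (f j))

    #embeddings : ℤ
    #embeddings = ∑ (allVecs (allFin n) k) λ f → ⟦ isEmbedding? (lookup f) ⟧

    private
      SpannedBy : VertexArcSets n → (Fin k → Fin n) → Set
      SpannedBy S f = IsSubdigraphOf S D × IsIso H S f

      spannedBy? : ∀ S f → Dec (SpannedBy S f)
      spannedBy? S f = isSubdigraphOf? S D ×-dec isIso? H S f

      InImage : (Fin k → Fin n) → Fin n → Set
      InImage f v = ∃ λ i → f i ≡ v

      ArcInImage : (Fin k → Fin n) → Fin n → Fin n → Set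
      ArcInImage f u v = ∃ λ i → ∃ λ j → f i ≡ u × f j ≡ v × Arc i j

      inImage? : ∀ f → Decidable (InImage f)
      inImage? f v = any? λ i → f i ≟ v

      arcInImage? : ∀ f u v → Dec (ArcInImage f u v)
      arcInImage? f u v = any? λ i → any? λ j → f i ≟ u ×-dec f j ≟ v ×-dec arc? i j

      image : (Fin k → Fin n) → VertexArcSets n
      image f = mkSets (subsetOf (inImage? f)) (tabulate λ u → subsetOf (arcInImage? f u))

      image-arc⁺ : ∀ f {u v} → ArcInImage f u v → HasArc (image f) u v
      image-arc⁺ f {u} {v} p = subst (v Subset.∈_) (sym (Vec.lookup∘tabulate _ u)) (∈-subsetOf⁺ (arcInImage? f u) p)

      image-arc⁻ : ∀ f {u v} → HasArc (image f) u v → ArcInImage f u v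
      image-arc⁻ f {u} {v} p = ∈-subsetOf⁻ (arcInImage? f u) (subst (v Subset.∈_) (Vec.lookup∘tabulate _ u) p)

      image-spanned : ∀ f → IsEmbedding f → SpannedBy (image f) f
      image-spanned f (inj , pres) = sub , into , (λ v → ∈-subsetOf⁻ (inImage? f)) , inj , arcs
        where
        into : ∀ i → f i Subset.∈ vertices (image f)
        into i = ∈-subsetOf⁺ (inImage? f) (i , refl)

        sub : IsSubdigraphOf (image f) D
        sub u v uv with i , j , refl , refl , ij ← image-arc⁻ f {u} {v} uv = into i , into j , pres i j ij

        arcs : ∀ i j → Arc i j ⇔ HasArc (image f) (f i) (f j)
        arcs i j = mk⇔ (λ ij → image-arc⁺ f (i , j , refl , refl , ij)) back
          where
          back : HasArc (image f) (f i) (f j) → Arc i j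
          -- Injectivity identifies the preimages `i′` and `j′` with `i` and `j`.
          back p with i′ , j′ , eqi , eqj , ij ← image-arc⁻ f {f i} {f j} p =
            subst₂ Arc (inj _ _ eqi) (inj _ _ eqj) ij

      spanned-embedding : ∀ {f S} → SpannedBy S f → IsEmbedding f
      spanned-embedding (sub , _ , _ , inj , arcs) =
        inj , λ i j ij → proj₂ (proj₂ (sub _ _ (Equivalence.to (arcs i j) ij)))

      -- The vertices and arcs of S are exactly the images under f.
      spanned-unique : ∀ {f S S′} → SpannedBy S f → SpannedBy S′ f → S ≡ S′
      spanned-unique {f} {S} {S′} p q = mkSets-ext (vs S S′ p q) (vs S′ S q p) (as S S′ p q) (as S′ S q p)
        where
        vs : ∀ S S′ → SpannedBy S f → SpannedBy S′ f → ∀ {v} → v Subset.∈ vertices S → v Subset.∈ vertices S′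
        vs _ _ (_ , _ , onto , _) (_ , into , _) v∈S with i , refl ← onto _ v∈S = into i

        as : ∀ S S′ → SpannedBy S f → SpannedBy S′ f → ∀ {u v} → HasArc S u v → HasArc S′ u v
        as _ _ (sub , _ , onto , _ , arcs) (_ , _ , _ , _ , arcs′) uv
          with u∈S , v∈S , _ ← sub _ _ uv
          with i , refl ← onto _ u∈S
          with j , refl ← onto _ v∈S = Equivalence.to (arcs′ i j) (Equivalence.from (arcs i j) uv)

      -- The maps spanning a copy are its isomorphisms with `H`, which `#iso≡#aut` counts; a set
      -- that is not a copy is spanned by none.
      #spanning : ∀ S → ∑ (allVecs (allFin n) k) (λ f → ⟦ spannedBy? S (lookup f) ⟧)
                        ≡ ⟦ isCopy? H D S ⟧ * #aut
      #spanning S with isCopy? H D S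
      ... | yes (S⊆D , φ) = begin
        ∑ fs (λ f → ⟦ spannedBy? S (lookup f) ⟧)
          ≡⟨ ∑-cong fs (λ f → ⟦⟧-⇔ (spannedBy? S (lookup f)) (isIso? H S (lookup f)) proj₂ (S⊆D ,_)) ⟩
        ∑ fs (λ f → ⟦ isIso? H S (lookup f) ⟧)
          ≡⟨ #iso≡#aut S (fromIso H S D S⊆D φ) ⟩
        #aut
          ≡⟨ ℤ.*-identityˡ #aut ⟨
        1ℤ * #aut ∎
        where fs = allVecs (allFin n) k
      ... | no ¬copy = trans
        (∑-cong (allVecs (allFin n) k) λ f → ⟦⟧-no (spannedBy? S (lookup f))
          λ { (S⊆D , iso) → ¬copy (S⊆D , toIso H S D S⊆D iso) })
        (∑-zero (allVecs (allFin n) k))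

    -- Double counting of pairs of a copy and a map spanning it: each copy is spanned by `#aut`
    -- maps, and each embedding spans its image alone.
    #copies*#aut≡#embeddings : pos (#copies H D) * #aut ≡ #embeddings
    #copies*#aut≡#embeddings = begin
      pos (#copies H D) * #aut
        ≡⟨ cong (_* #aut) (length-filter-∑ (isCopy? H D) Ss) ⟩
      ∑ Ss (λ S → ⟦ isCopy? H D S ⟧) * #aut
        ≡⟨ ∑-*ʳ Ss #aut _ ⟨
      ∑ Ss (λ S → ⟦ isCopy? H D S ⟧ * #aut)
        ≡⟨ ∑-cong Ss #spanning ⟨
      ∑ Ss (λ S → ∑ fs λ f → ⟦ spannedBy? S (lookup f) ⟧)
        ≡⟨ ∑-swap Ss fs _ ⟩
      ∑ fs (λ f → ∑ Ss λ S → ⟦ spannedBy? S (lookup f) ⟧)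
        ≡⟨ ∑-cong fs (λ f → ∑-fibre (enumerates-allVertexArcSets n) (isEmbedding? (lookup f))
             (λ S → spannedBy? S (lookup f))
             (λ emb → image (lookup f) , image-spanned (lookup f) emb)
             (λ {S} → spanned-embedding {S = S}) spanned-unique) ⟩
      #embeddings ∎
      where
      Ss = allVertexArcSets n
      fs = allVecs (allFin n) k

  #copies-cong : ∀ {D D′ : Digraph (Fin n)} → #embeddings D ≡ #embeddings D′ → #copies H D ≡ #copies H D′
  #copies-cong {D = D} {D′} eq = ℤ.+-injective (ℤ.*-cancelʳ-≡ _ _ #aut (begin
    pos (#copies H D) * #aut   ≡⟨ #copies*#aut≡#embeddings D ⟩
    #embeddings D              ≡⟨ eq ⟩
    #embeddings D′             ≡⟨ #copies*#aut≡#embeddings D′ ⟨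
    pos (#copies H D′) * #aut  ∎))
    where instance _ = ℤ.>-nonZero (ℤ.<-≤-trans (ℤ.+<+ (s≤s z≤n)) 1≤#aut)

-- Signed sums over injective maps

∏ : List A → (A → ℤ) → ℤ
∏ []       f = 1ℤ
∏ (x ∷ xs) f = f x * ∏ xs f

∏-cong : ∀ (xs : List A) {f g : A → ℤ} → (∀ {x} → x ∈ xs → f x ≡ g x) → ∏ xs f ≡ ∏ xs g
∏-cong []       f≗g = refl
∏-cong (x ∷ xs) f≗g = cong₂ _*_ (f≗g (here refl)) (∏-cong xs (f≗g ∘ there))

∏-map : ∀ {B : Set} (h : A → B) xs (f : B → ℤ) → ∏ (map h xs) f ≡ ∏ xs (f ∘ h)
∏-map h []       f = refl
∏-map h (x ∷ xs) f = cong (f (h x) *_) (∏-map h xs f)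

∏-↭ : ∀ {xs ys : List A} (f : A → ℤ) → xs ↭ ys → ∏ xs f ≡ ∏ ys f
∏-↭ f ↭.refl         = refl
∏-↭ f (↭.prep x p)   = cong (f x *_) (∏-↭ f p)
∏-↭ f (↭.swap x y p) = trans (cong (λ r → f x * (f y * r)) (∏-↭ f p)) (exchange (f x) (f y) _)
  where
  exchange : ∀ a b c → a * (b * c) ≡ b * (a * c)
  exchange = solve-∀
∏-↭ f (↭.trans p q)  = trans (∏-↭ f p) (∏-↭ f q)

∏-neg : ∀ (L : List (Edge k)) f → ∏ L (λ e → - f e) ≡ sgn L * ∏ L f
∏-neg []      f = refl
∏-neg (e ∷ L) f = trans (cong (- f e *_) (∏-neg L f)) (regroup (f e) (sgn L) (∏ L f))
  where
  regroup : ∀ a b c → - a * (b * c) ≡ -1ℤ * b * (a * c)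
  regroup = solve-∀

∏-double : ∀ (xs : List A) (f : A → ℤ) → ∏ xs (λ x → pos 2 * f x) ≡ pos (2 ℕ.^ length xs) * ∏ xs f
∏-double []       f = refl
∏-double (x ∷ xs) f = begin
  pos 2 * f x * ∏ xs (λ x → pos 2 * f x)       ≡⟨ cong (pos 2 * f x *_) (∏-double xs f) ⟩
  pos 2 * f x * (pos (2 ℕ.^ length xs) * ∏ xs f) ≡⟨ regroup (pos 2) (f x) (pos (2 ℕ.^ length xs)) (∏ xs f) ⟩
  pos 2 * pos (2 ℕ.^ length xs) * (f x * ∏ xs f) ≡⟨ cong (_* (f x * ∏ xs f)) (ℤ.pos-* 2 (2 ℕ.^ length xs)) ⟨
  pos (2 ℕ.^ length (x ∷ xs)) * ∏ (x ∷ xs) f   ∎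
  where
  regroup : ∀ a b c d → a * b * (c * d) ≡ a * c * (b * d)
  regroup = solve-∀

∏-⟦⟧ : ∀ {P : A → Set} (P? : Decidable P) xs → ∏ xs (λ x → ⟦ P? x ⟧) ≡ ⟦ All.all? P? xs ⟧
∏-⟦⟧ P? []       = refl
∏-⟦⟧ P? (x ∷ xs) = begin
  ⟦ P? x ⟧ * ∏ xs (λ x → ⟦ P? x ⟧)    ≡⟨ cong (⟦ P? x ⟧ *_) (∏-⟦⟧ P? xs) ⟩
  ⟦ P? x ⟧ * ⟦ All.all? P? xs ⟧       ≡⟨ ⟦⟧-× (P? x) (All.all? P? xs) ⟨
  ⟦ P? x ×-dec All.all? P? xs ⟧       ≡⟨ ⟦⟧-⇔ (P? x ×-dec All.all? P? xs) (All.all? P? (x ∷ xs))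
                                             (λ (p , ps) → p ∷ ps) (λ { (p ∷ ps) → p , ps }) ⟩
  ⟦ All.all? P? (x ∷ xs) ⟧            ∎

pull : (Fin n → Fin n → ℤ) → (Fin k → Fin n) → Edge k → ℤ
pull s f (i , j) = s (f i) (f j)

∑ⁱ : ((Fin k → Fin n) → ℤ) → ℤ
∑ⁱ {k} {n} F = ∑ (allVecs (allFin n) k) λ v → ⟦ injective? (lookup v) ⟧ * F (lookup v)

∑ⁱ-cong : ∀ {F G : (Fin k → Fin n) → ℤ} → (∀ f → F f ≡ G f) → ∑ⁱ F ≡ ∑ⁱ G
∑ⁱ-cong {k} {n} eq = ∑-cong (allVecs (allFin n) k) λ v → cong (⟦ injective? (lookup v) ⟧ *_) (eq (lookup v))

∑ⁱ-+ : ∀ (F G : (Fin k → Fin n) → ℤ) → ∑ⁱ (λ f → F f + G f) ≡ ∑ⁱ F + ∑ⁱ G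
∑ⁱ-+ {k} {n} F G = trans
  (∑-cong (allVecs (allFin n) k) λ v → ℤ.*-distribˡ-+ ⟦ injective? (lookup v) ⟧ (F (lookup v)) (G (lookup v)))
  (∑-+ (allVecs (allFin n) k) _ _)

∑ⁱ-*ˡ : ∀ c (F : (Fin k → Fin n) → ℤ) → ∑ⁱ (λ f → c * F f) ≡ c * ∑ⁱ F
∑ⁱ-*ˡ {k} {n} c F = trans
  (∑-cong (allVecs (allFin n) k) λ v → exchange ⟦ injective? (lookup v) ⟧ c (F (lookup v)))
  (∑-*ˡ (allVecs (allFin n) k) c _)
  where
  exchange : ∀ a b c → a * (b * c) ≡ b * (a * c)
  exchange = solve-∀

-- Composing with `π` permutes the injective maps. The composite is stored as a vector and agrees
-- with the original only pointwise, whence the condition on `F`.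
∑ⁱ-∘ : ∀ (π : Permutation′ k) (F : (Fin k → Fin n) → ℤ) → (∀ {f g} → f ≗ g → F f ≡ F g) →
       ∑ⁱ (λ f → F (f ∘ (π ⟨$⟩ʳ_))) ≡ ∑ⁱ F
∑ⁱ-∘ {k} {n} π F F-cong = begin
  ∑ vs (λ v → ⟦ injective? (lookup v) ⟧ * F (lookup v ∘ (π ⟨$⟩ʳ_)))  ≡⟨ ∑-cong vs step ⟩
  ∑ vs (G ∘ φ)                                                       ≡⟨ ∑-reindex (enumerates-maps k n) (enumerates-maps k n) φ ψ φψ ψφ G ⟩
  ∑ vs G                                                             ∎
  where
  vs = allVecs (allFin n) k
  G : Vec (Fin n) k → ℤ
  G v = ⟦ injective? (lookup v) ⟧ * F (lookup v)
  φ ψ : Vec (Fin n) k → Vec (Fin n) k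
  φ v = tabulate (lookup v ∘ (π ⟨$⟩ʳ_))
  ψ v = tabulate (lookup v ∘ (π ⟨$⟩ˡ_))

  φ-lookup : ∀ v i → lookup (φ v) i ≡ lookup v (π ⟨$⟩ʳ i)
  φ-lookup v = Vec.lookup∘tabulate _

  ψ-lookup : ∀ v i → lookup (ψ v) i ≡ lookup v (π ⟨$⟩ˡ i)
  ψ-lookup v = Vec.lookup∘tabulate _

  φψ : ∀ v → φ (ψ v) ≡ v
  φψ v = lookup-injective λ i → trans (φ-lookup (ψ v) i)
    (trans (ψ-lookup v _) (cong (lookup v) (Perm.inverseˡ π)))

  ψφ : ∀ v → ψ (φ v) ≡ v
  ψφ v = lookup-injective λ i → trans (ψ-lookup (φ v) i)
    (trans (φ-lookup v _) (cong (lookup v) (Perm.inverseʳ π)))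

  φ-injective⁺ : ∀ v → Injective (lookup v) → Injective (lookup (φ v))
  φ-injective⁺ v inj i j eq = trans (sym (Perm.inverseˡ π))
    (trans (cong (π ⟨$⟩ˡ_) (inj _ _ (trans (sym (φ-lookup v i)) (trans eq (φ-lookup v j))))) (Perm.inverseˡ π))

  φ-injective⁻ : ∀ v → Injective (lookup (φ v)) → Injective (lookup v)
  φ-injective⁻ v inj i j eq = trans (sym (Perm.inverseʳ π))
    (trans (cong (π ⟨$⟩ʳ_) (inj _ _ (trans (at i) (trans eq (sym (at j)))))) (Perm.inverseʳ π))
    where
    at : ∀ i → lookup (φ v) (π ⟨$⟩ˡ i) ≡ lookup v i
    at i = trans (φ-lookup v _) (cong (lookup v) (Perm.inverseʳ π))

  step : ∀ v → ⟦ injective? (lookup v) ⟧ * F (lookup v ∘ (π ⟨$⟩ʳ_)) ≡ G (φ v)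
  step v = cong₂ _*_
    (⟦⟧-⇔ (injective? (lookup v)) (injective? (lookup (φ v))) (φ-injective⁺ v) (φ-injective⁻ v))
    (F-cong λ i → sym (φ-lookup v i))

-- The sums W of an antisymmetric score

module _ (s : Fin n → Fin n → ℤ) (antisym : ∀ u v → s u v ≡ - s v u) where

  W : List (Edge k) → ℤ
  W L = ∑ⁱ λ f → ∏ L (pull s f)

  -- The three laws come from commutativity of the product, antisymmetry of `s` and reindexing of
  -- the injective maps.
  W-alternating : Alternating (W {k})
  W-alternating = record
    { W-↭       = λ p → ∑ⁱ-cong λ f → ∏-↭ (pull s f) p
    ; W-flip    = λ i j L → begin
        ∑ⁱ (λ f → s (f i) (f j) * ∏ L (pull s f))
          ≡⟨ ∑ⁱ-cong (λ f → trans (cong (_* ∏ L (pull s f)) (antisym (f i) (f j)))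
                                    (negate (s (f j) (f i)) (∏ L (pull s f)))) ⟩
        ∑ⁱ (λ f → -1ℤ * (s (f j) (f i) * ∏ L (pull s f)))
          ≡⟨ ∑ⁱ-*ˡ -1ℤ (λ f → ∏ ((j , i) ∷ L) (pull s f)) ⟩
        -1ℤ * W ((j , i) ∷ L)
          ≡⟨ ℤ.-1*i≡-i _ ⟩
        - W ((j , i) ∷ L) ∎
    ; W-relabel = λ π L → trans (∑ⁱ-cong λ f → ∏-map (relabel π) L (pull s f))
        (∑ⁱ-∘ π (λ f → ∏ L (pull s f)) λ f≗g → ∏-cong L λ {(i , j)} _ → cong₂ s (f≗g i) (f≗g j))
    }
    where
    negate : ∀ a b → - a * b ≡ -1ℤ * (a * b)
    negate = solve-∀

W-flip-score : ∀ (s : Fin n → Fin n → ℤ) (antisym : ∀ u v → s u v ≡ - s v u) (L : List (Edge k)) →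
              W (flip s) (λ u v → antisym v u) L ≡ sgn L * W s antisym L
W-flip-score s antisym L = trans
  (∑ⁱ-cong λ f → trans (∏-cong L λ {(i , j)} _ → antisym (f j) (f i)) (∏-neg L (pull s f)))
  (∑ⁱ-*ˡ (sgn L) λ f → ∏ L (pull s f))

-- Flipping the score multiplies by the sign of `L`. This is 1 for even length, and for odd length
-- both sides vanish.
W-reverse : ∀ (s : Fin n → Fin n → ℤ) (antisym : ∀ u v → s u v ≡ - s v u) (L : List (Edge k)) →
            MaxDegree≤2 L → W s antisym L ≡ W (flip s) (λ u v → antisym v u) L
W-reverse s antisym L deg≤2 with sgn-values L
... | inj₁ even = sym (trans (W-flip-score s antisym L) (trans (cong (_* W s antisym L) even) (ℤ.*-identityˡ _)))
... | inj₂ odd  = trans (odd-vanishes (W-alternating s antisym) L deg≤2 odd)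
  (sym (odd-vanishes (W-alternating (flip s) (λ u v → antisym v u)) L deg≤2 odd))

-- The product over M of 1 + s is expanded one edge at a time; L collects the
-- edges at which the summand s has been chosen.
mixed : (Fin n → Fin n → ℤ) → List (Edge k) → List (Edge k) → ℤ
mixed s L M = ∑ⁱ λ f → ∏ L (pull s f) * ∏ M (λ e → 1ℤ + pull s f e)

mixed-[] : ∀ (s : Fin n → Fin n → ℤ) (antisym : ∀ u v → s u v ≡ - s v u) (L : List (Edge k)) →
           mixed s L [] ≡ W s antisym L
mixed-[] s antisym L = ∑ⁱ-cong λ f → ℤ.*-identityʳ (∏ L (pull s f))

mixed-∷ : ∀ (s : Fin n → Fin n → ℤ) (L : List (Edge k)) e M →
          mixed s L (e ∷ M) ≡ mixed s L M + mixed s (e ∷ L) M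
mixed-∷ s L e M = trans
  (∑ⁱ-cong λ f → expand (∏ L (pull s f)) (pull s f e) (∏ M (λ e → 1ℤ + pull s f e)))
  (∑ⁱ-+ (λ f → ∏ L (pull s f) * ∏ M (λ e → 1ℤ + pull s f e)) (λ f → ∏ (e ∷ L) (pull s f) * ∏ M (λ e → 1ℤ + pull s f e)))
  where
  expand : ∀ a b c → a * ((1ℤ + b) * c) ≡ a * c + b * a * c
  expand = solve-∀

-- Induction on the factors still to be expanded. Dropping an edge or moving it from `M` to `L`
-- raises no degree, so both summands inherit the bound.
mixed-reverse : ∀ (s : Fin n → Fin n → ℤ) → (∀ u v → s u v ≡ - s v u) → ∀ (L M : List (Edge k)) →
                MaxDegree≤2 (L ++ M) → mixed s L M ≡ mixed (flip s) L M
mixed-reverse s antisym L [] deg≤2 = begin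
  mixed s L []                                      ≡⟨ mixed-[] s antisym L ⟩
  W s antisym L                                     ≡⟨ W-reverse s antisym L
                                                        (MaxDegree≤2-~ (permute (↭ₚ.++-identityʳ L)) deg≤2) ⟩
  W (flip s) (λ u v → antisym v u) L       ≡⟨ mixed-[] (flip s) (λ u v → antisym v u) L ⟨
  mixed (flip s) L []                      ∎
mixed-reverse s antisym L (e ∷ M) deg≤2 = begin
  mixed s L (e ∷ M)                                                     ≡⟨ mixed-∷ s L e M ⟩
  mixed s L M + mixed s (e ∷ L) M                                       ≡⟨ cong₂ _+_
    (mixed-reverse s antisym L M λ v → ℕ.≤-trans (ℕ.m≤n+m _ _) (shifted v)) (mixed-reverse s antisym (e ∷ L) M shifted) ⟩
  mixed (flip s) L M + mixed (flip s) (e ∷ L) M       ≡⟨ mixed-∷ (flip s) L e M ⟨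
  mixed (flip s) L (e ∷ M)                                     ∎
  where
  shifted : MaxDegree≤2 (e ∷ L ++ M)
  shifted = MaxDegree≤2-~ (permute (↭ₚ.shift e L M)) deg≤2

-- The arc list of H and its degrees

module _ (H : Digraph (Fin k)) where
  open Digraph H using (Arc; arc?)

  arcs : List (Edge k)
  arcs = filter (λ (i , j) → arc? i j) (List.cartesianProduct (allFin k) (allFin k))

  ∈-arcs⁺ : ∀ {i j} → Arc i j → (i , j) ∈ arcs
  ∈-arcs⁺ {i} {j} = ∈-filter⁺ (λ (i , j) → arc? i j) (∈-cartesianProduct⁺ (∈-allFin i) (∈-allFin j))

  ∈-arcs⁻ : ∀ {i j} → (i , j) ∈ arcs → Arc i j
  ∈-arcs⁻ e∈ = proj₂ (∈-filter⁻ (λ (i , j) → arc? i j) {xs = List.cartesianProduct (allFin k) (allFin k)} e∈)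

  private
    δ-⟦⟧ : ∀ (v i : Fin k) → pos (δ v i) ≡ ⟦ i ≟ v ⟧
    δ-⟦⟧ v i with v ≟ i
    ... | yes v≡i = sym (⟦⟧-yes (i ≟ v) (sym v≡i))
    ... | no  v≢i = sym (⟦⟧-no (i ≟ v) (v≢i ∘ sym))

    deg-∑ : ∀ v (L : List (Edge k)) → pos (deg v L) ≡ ∑ L (λ (i , j) → ⟦ i ≟ v ⟧ + ⟦ j ≟ v ⟧)
    deg-∑ v []            = refl
    deg-∑ v ((i , j) ∷ L) = cong₂ _+_ (cong₂ _+_ (δ-⟦⟧ v i) (δ-⟦⟧ v j)) (deg-∑ v L)

  -- With opposite arcs, deg would count a neighbour twice.
  deg-arcs : (∀ {i j} → Arc i j → ¬ Arc j i) → ∀ v → deg v arcs ≡ degree (underlying H) v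
  deg-arcs asym v = ℤ.+-injective (begin
    pos (deg v arcs)
      ≡⟨ deg-∑ v arcs ⟩
    ∑ arcs (λ (i , j) → ⟦ i ≟ v ⟧ + ⟦ j ≟ v ⟧)
      ≡⟨ ∑-filter (λ (i , j) → arc? i j) (List.cartesianProduct is is) _ ⟩
    ∑ (List.cartesianProduct is is) (λ (i , j) → ⟦ arc? i j ⟧ * (⟦ i ≟ v ⟧ + ⟦ j ≟ v ⟧))
      ≡⟨ ∑-cartesianProductWith _,_ is is _ ⟩
    ∑ is (λ i → ∑ is λ j → ⟦ arc? i j ⟧ * (⟦ i ≟ v ⟧ + ⟦ j ≟ v ⟧))
      ≡⟨ ∑-cong is (λ i → trans (∑-cong is λ j → distribute ⟦ arc? i j ⟧ ⟦ i ≟ v ⟧ ⟦ j ≟ v ⟧) (∑-+ is _ _)) ⟩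
    ∑ is (λ i → ∑ is (λ j → ⟦ i ≟ v ⟧ * ⟦ arc? i j ⟧) + ∑ is (λ j → ⟦ j ≟ v ⟧ * ⟦ arc? i j ⟧))
      ≡⟨ ∑-cong is (λ i → cong₂ _+_ (∑-*ˡ is ⟦ i ≟ v ⟧ _) (∑-sift (enumerates-allFin k) v (λ j → ⟦ arc? i j ⟧))) ⟩
    ∑ is (λ i → ⟦ i ≟ v ⟧ * ∑ is (λ j → ⟦ arc? i j ⟧) + ⟦ arc? i v ⟧)
      ≡⟨ ∑-+ is _ _ ⟩
    ∑ is (λ i → ⟦ i ≟ v ⟧ * ∑ is (λ j → ⟦ arc? i j ⟧)) + ∑ is (λ i → ⟦ arc? i v ⟧)
      ≡⟨ cong (_+ ∑ is (λ i → ⟦ arc? i v ⟧)) (∑-sift (enumerates-allFin k) v (λ i → ∑ is λ j → ⟦ arc? i j ⟧)) ⟩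
    -- The two sums count the arcs leaving `v` and those entering it.
    ∑ is (λ j → ⟦ arc? v j ⟧) + ∑ is (λ i → ⟦ arc? i v ⟧)
      ≡⟨ ∑-+ is _ _ ⟨
    ∑ is (λ j → ⟦ arc? v j ⟧ + ⟦ arc? j v ⟧)
      ≡⟨ ∑-cong is (λ j → disjoint (arc? v j) (arc? j v) asym) ⟩
    ∑ is (λ j → ⟦ arc? v j ⊎-dec arc? j v ⟧)
      ≡⟨ length-filter-∑ (Graph.adj? (underlying H) v) is ⟨
    pos (degree (underlying H) v) ∎)
    where
    is = allFin k

    distribute : ∀ a b c → a * (b + c) ≡ b * a + c * a
    distribute = solve-∀

    disjoint : (d : Dec P) (e : Dec Q) → (P → ¬ Q) → ⟦ d ⟧ + ⟦ e ⟧ ≡ ⟦ d ⊎-dec e ⟧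
    disjoint (yes p) (yes q) p⇒¬q = contradiction q (p⇒¬q p)
    disjoint (yes _) (no _)  _    = refl
    disjoint (no _)  (yes _) _    = refl
    disjoint (no _)  (no _)  _    = refl

  degree≤Δ : ∀ v → degree (underlying H) v ≤ Δ (underlying H)
  degree≤Δ v = All.lookup (xs≤max 0 (map (degree (underlying H)) (allFin k)))
                          (∈-map⁺ (degree (underlying H)) (∈-allFin v))

-- Embeddings in terms of the score of a tournament

module _ (T : Tournament n) where
  open Tournament T
  open Digraph digraph

  -- As a difference of indicators, antisymmetry is a ring identity and the score of the complement
  -- is the flipped score by computation.
  score : Fin n → Fin n → ℤ
  score u v = ⟦ arc? u v ⟧ - ⟦ arc? v u ⟧

  score-antisym : ∀ u v → score u v ≡ - score v u
  score-antisym u v = antisym ⟦ arc? u v ⟧ ⟦ arc? v u ⟧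
    where
    antisym : ∀ a b → a - b ≡ - (b - a)
    antisym = solve-∀

  tournament-asym : ∀ {u v} → Arc u v → ¬ Arc v u
  tournament-asym {u} {v} uv vu with trichotomous u v
  ... | tri< _  _ ¬vu = ¬vu vu
  ... | tri≈ ¬uv _ _  = ¬uv uv
  ... | tri> ¬uv _ _  = ¬uv uv

  -- Exactly one of the two arcs is present, so the left side is 2 or 0. For equal vertices it would
  -- be 1.
  1+score : ∀ {u v} → u ≢ v → 1ℤ + score u v ≡ pos 2 * ⟦ arc? u v ⟧
  1+score {u} {v} u≢v with trichotomous u v
  ... | tri< uv _ ¬vu rewrite ⟦⟧-yes (arc? u v) uv | ⟦⟧-no (arc? v u) ¬vu = refl
  ... | tri≈ _ u≡v _  = contradiction u≡v u≢v
  ... | tri> ¬uv _ vu rewrite ⟦⟧-no (arc? u v) ¬uv | ⟦⟧-yes (arc? v u) vu = refl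

  module _ (H : Digraph (Fin k)) where

    -- A factor 2 for each arc clears the denominators of the indicators. The ends of an arc have
    -- distinct images because `H` has no loops and `f` is injective.
    #embeddings-mixed : pos (2 ℕ.^ length (arcs H)) * #embeddings H digraph ≡ mixed score [] (arcs H)
    #embeddings-mixed = trans (sym (∑-*ˡ (allVecs (allFin n) k) c λ v → ⟦ isEmbedding? H digraph (lookup v) ⟧))
                                (∑-cong (allVecs (allFin n) k) λ v → pointwise (lookup v))
      where
      c = pos (2 ℕ.^ length (arcs H))

      preserved? : ∀ f → Decidable (λ ((i , j) : Edge k) → Arc (f i) (f j))
      preserved? f (i , j) = arc? (f i) (f j)

      split : ∀ f → ⟦ isEmbedding? H digraph f ⟧ ≡ ⟦ injective? f ⟧ * ⟦ All.all? (preserved? f) (arcs H) ⟧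
      split f = trans
        (⟦⟧-⇔ (isEmbedding? H digraph f) (injective? f ×-dec All.all? (preserved? f) (arcs H))
          (λ (inj , pres) → inj , All.tabulate λ e∈ → pres _ _ (∈-arcs⁻ H e∈))
          (λ (inj , pres) → inj , λ i j ij → All.lookup pres (∈-arcs⁺ H ij)))
        (⟦⟧-× (injective? f) (All.all? (preserved? f) (arcs H)))

      factors : ∀ f → Injective f →
                ∏ (arcs H) (λ e → 1ℤ + pull score f e) ≡ c * ⟦ All.all? (preserved? f) (arcs H) ⟧
      factors f inj = begin
        ∏ (arcs H) (λ e → 1ℤ + pull score f e)
          ≡⟨ ∏-cong (arcs H) (λ {(i , j)} e∈ → 1+score λ fi≡fj → Digraph.irrefl H (inj i j fi≡fj) (∈-arcs⁻ H e∈)) ⟩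
        ∏ (arcs H) (λ e → pos 2 * ⟦ preserved? f e ⟧)
          ≡⟨ ∏-double (arcs H) _ ⟩
        c * ∏ (arcs H) (λ e → ⟦ preserved? f e ⟧)
          ≡⟨ cong (c *_) (∏-⟦⟧ (preserved? f) (arcs H)) ⟩
        c * ⟦ All.all? (preserved? f) (arcs H) ⟧ ∎

      -- The inner factor `1ℤ` is the empty product: no edge has been collected yet.
      pointwise : ∀ f → c * ⟦ isEmbedding? H digraph f ⟧ ≡
                        ⟦ injective? f ⟧ * (1ℤ * ∏ (arcs H) (λ e → 1ℤ + pull score f e))
      pointwise f = trans (cong (c *_) (split f)) (cases (injective? f))
        where
        cases : (d : Dec (Injective f)) → c * (⟦ d ⟧ * ⟦ All.all? (preserved? f) (arcs H) ⟧) ≡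
                                          ⟦ d ⟧ * (1ℤ * ∏ (arcs H) (λ e → 1ℤ + pull score f e))
        cases (no _)    = ℤ.*-zeroʳ c
        cases (yes inj) = begin
          c * (1ℤ * ⟦ All.all? (preserved? f) (arcs H) ⟧)        ≡⟨ cong (c *_) (ℤ.*-identityˡ _) ⟩
          c * ⟦ All.all? (preserved? f) (arcs H) ⟧               ≡⟨ factors f inj ⟨
          ∏ (arcs H) (λ e → 1ℤ + pull score f e)                 ≡⟨ ℤ.*-identityˡ _ ⟨
          1ℤ * ∏ (arcs H) (λ e → 1ℤ + pull score f e)            ≡⟨ ℤ.*-identityˡ _ ⟨
          1ℤ * (1ℤ * ∏ (arcs H) (λ e → 1ℤ + pull score f e))     ∎

    digon-#embeddings : ∀ {i j} → Digraph.Arc H i j → Digraph.Arc H j i → #embeddings H digraph ≡ 0ℤ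
    digon-#embeddings ij ji = trans
      (∑-cong (allVecs (allFin n) k) λ v → ⟦⟧-no (isEmbedding? H digraph (lookup v))
        λ (_ , pres) → tournament-asym (pres _ _ ij) (pres _ _ ji))
      (∑-zero (allVecs (allFin n) k))

-- If `H` has opposite arcs, both counts are zero. Otherwise the degrees of the arc list are those
-- of the underlying graph, and the common power of two is cancelled.
#embeddings-complement : ∀ (T : Tournament n) (H : Digraph (Fin k)) → Δ (underlying H) ≤ 2 →
  #embeddings H (Tournament.digraph T) ≡ #embeddings H (Tournament.digraph (complement T))
#embeddings-complement T H Δ≤2 with any? (λ i → any? λ j → Digraph.arc? H i j ×-dec Digraph.arc? H j i)
... | yes (_ , _ , ij , ji) = trans (digon-#embeddings T H ij ji) (sym (digon-#embeddings (complement T) H ij ji))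
... | no ¬digon = ℤ.*-cancelˡ-≡ (pos (2 ℕ.^ length (arcs H))) _ _ (begin
  pos (2 ℕ.^ length (arcs H)) * #embeddings H (Tournament.digraph T)               ≡⟨ #embeddings-mixed T H ⟩
  mixed (score T) [] (arcs H)                                                      ≡⟨ mixed-reverse (score T) (score-antisym T) [] (arcs H) deg≤2 ⟩
  -- This is the sum for `flip (score T)` by definition of the complement.
  mixed (score (complement T)) [] (arcs H)                                         ≡⟨ #embeddings-mixed (complement T) H ⟨
  pos (2 ℕ.^ length (arcs H)) * #embeddings H (Tournament.digraph (complement T))  ∎)
  where
  instance _ = ℕ.m^n≢0 2 (length (arcs H))

  deg≤2 : MaxDegree≤2 (arcs H)
  deg≤2 v = ℕ.≤-trans
    (ℕ.≤-reflexive (deg-arcs H (λ ij ji → ¬digon (_ , _ , ij , ji)) v))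
    (ℕ.≤-trans (degree≤Δ H v) Δ≤2)

theorem23 : ∀ {n k : ℕ} (T : Tournament n) (H : Digraph (Fin k)) →
    Δ (underlying H) ≤ 2 →
    #copies H (Tournament.digraph T)
    ≡ #copies H (Tournament.digraph (complement T))
theorem23 T H Δ≤2 = #copies-cong H (#embeddings-complement T H Δ≤2)
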